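{- For arbitrary positive integer constants $\beta,\kappa$, each instance $(\mathcal{C}_S,\mathcal{C}_T)$ of $\beta$-\textsc{Repacking}-$\kappa$ can be solved in time that is linear in the length of the input's binary encoding.
   Context: Items are positive integers; a bunch is a finite (possibly empty) multiset of items, with volume the sum of its items; a configuration is a finite multiset of bunches, legal for capacity $\kappa$ if every bunch has volume at most $\kappa$; its underlying set is the multiset union of the items of its bunches. Two legal configurations $\mathcal{C},\mathcal{D}$ for capacity $\kappa$ are adjacent if $\mathcal{D}$ is formed from $\mathcal{C}$ by the move of a single item: $\mathcal{C}\setminus\mathcal{D}$ consists of two bunches $B_d,B_r$, $\mathcal{D}\setminus\mathcal{C}$ of two bunches $B_d',B_r'$, and for some item $u$ in $B_d$, $B_d'$ is $B_d$ with one copy of $u$ removed and $B_r'$ is $B_r$ with one copy of $u$ added. A partition of a multiset $U$ of items is a sequence $\mathbf{P}=(P_1,\dots,P_{|\mathbf{P}|})$ of parts $P_i=(U_i,\beta_i)$, where $U_i$ is a multiset of items, $\beta_i$ is a positive integer, and the multiset union of the $U_i$ is $U$; it is $\beta$-bounded if $\beta_i\le\beta$ for all $i$. An assignment of $\mathbf{P}$ for capacity $\kappa$ is a sequence $\mathbf{A}=(\mathcal{A}_1,\dots,\mathcal{A}_{|\mathbf{P}|})$ of multisets of bunches such that, for each $i$, the multiset union of the items in $\mathcal{A}_i$ is $U_i$, $\mathcal{A}_i$ has exactly $\beta_i$ bunches, and each bunch has volume at most $\kappa$; $\mathcal{A}_i$ is the $i$th portion. $\mathbf{A}$ is consistent with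 a configuration $\mathcal{C}$ if the disjoint multiset union of the $\mathcal{A}_i$ equals $\mathcal{C}$. Two assignments of $\mathbf{P}$ are adjacent if there is exactly one index $j$ at which their $j$th portions are adjacent as configurations, and all other portions are equal. A $\mathbf{P}$-conforming reconfiguration sequence for capacity $\kappa$ from $\mathcal{C}_S$ to $\mathcal{C}_T$ is a sequence of assignments of $\mathbf{P}$ for capacity $\kappa$, the first consistent with $\mathcal{C}_S$ and the last consistent with $\mathcal{C}_T$, with consecutive assignments adjacent. The problem $\beta$-\textsc{Repacking}-$\kappa$ (for fixed positive integers $\beta,\kappa$): Input: legal source and target configurations $\mathcal{C}_S,\mathcal{C}_T$ for capacity $\kappa$. Question: is there a $\beta$-bounded partition $\mathbf{P}$ of the underlying set of $\mathcal{C}_S$ such that there exists a $\mathbf{P}$-conforming reconfiguration sequence for capacity $\kappa$ from $\mathcal{C}_S$ to $\mathcal{C}_T$? Encoding: each of $\mathcal{C}_S,\mathcal{C}_T$ is given as a list of ordered pairs (bunch type, multiplicity), one for each bunch type that occurs; a bunch type is encoded by a unique integer identifier, and multiplicities are encoded in binary. -}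

module Defs where

open import Data.Bool.Base using (Bool; true; if_then_else_)
open import Data.Digit using (Bit; toDigits)
open import Data.Fin.Base using (Fin)
open import Data.List.Base
  using (List; []; _∷_; [_]; _++_; map; concat; concatMap; length; lookup;
         replicate; reverse; tabulate)
open import Data.List.Membership.Propositional using (_∈_)
open import Data.List.Relation.Unary.All using (All)
open import Data.List.Relation.Unary.AllPairs using (AllPairs)
import Data.List.Relation.Binary.Permutation.Setoid as Permutation
import Data.List.Relation.Binary.Permutation.Setoid.Properties as Permutationₚ
import Data.List.Membership.Setoid.Properties as Membershipₚ
open import Data.List.Relation.Unary.Any using (any?; here)
open import Data.Maybe.Base using (Maybe; just; nothing)
open import Data.Nat.Base using (ℕ; zero; suc; _≤_; NonZero)
open import Data.Nat.ListAction using (sum)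
import Data.Nat.Properties as ℕ
open import Data.Product.Base using (∃; _×_; _,_; proj₁; proj₂)
open import Data.Product using (∃!)
open import Data.Refinement using (Refinement-syntax; value) renaming (_≟_ to ≟-by)
open import Data.Sum.Base using (_⊎_; inj₁)
open import Data.Vec.Base as Vec using (Vec; _∷_)
open import Function.Base using (_∘_)
open import Function.Bundles using (_⇔_; _↔_)
open import Level using (_⊔_)
open import Relation.Binary.Bundles using (DecSetoid)
open import Relation.Binary.Construct.Closure.ReflexiveTransitive using (Star)
open import Relation.Binary.Definitions using (Decidable)
open import Relation.Binary.PropositionalEquality.Core using (_≡_; _≢_)
open import Relation.Binary.PropositionalEquality.Properties using (decSetoid)
open import Relation.Nullary.Decidable.Core using (yes; no; does; map′)
open import Relation.Nullary.Negation.Core using (¬_)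

-- Finite multisets are lists, compared up to permutation (and up to the
-- equality of their elements).

module Multiset {a ℓ} (S : DecSetoid a ℓ) where
  open DecSetoid S using (_≈_; _≟_) renaming (Carrier to A; setoid to S′; sym to ≈-sym)
  open Permutation S′ public using (_↭_)
  open Permutation S′ using (↭-refl; ↭-sym; ↭-trans; ↭-prep; ↭-reflexive-≋; ↭-isEquivalence)
  open Permutationₚ S′ using (drop-∷; shift; ∈-resp-↭; ¬x∷xs↭[])

  remove : A → List A → List A
  remove x []       = []
  remove x (y ∷ ys) = if does (x ≟ y) then ys else y ∷ remove x ys

  -- Multiset difference: multiplicities are subtracted, truncating at 0.
  infixl 5 _∖_
  _∖_ : List A → List A → List A
  xs ∖ []       = xs
  xs ∖ (y ∷ ys) = remove y xs ∖ ys

  infix 4 _↭?_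
  _↭?_ : Decidable _↭_
  []       ↭? []       = yes ↭-refl
  []       ↭? (y ∷ ys) = no λ p → ¬x∷xs↭[] (↭-sym p)
  (x ∷ xs) ↭? ys with any? (x ≟_) ys
  ... | no  x∉ys = no λ p → x∉ys (∈-resp-↭ p (here (DecSetoid.refl S)))
  ... | yes x∈ys =
    let hs , ts , _ , x≈w , eq = Membershipₚ.∈-∃++ S′ x∈ys
        ys↭ = ↭-trans (↭-reflexive-≋ eq) (shift (≈-sym x≈w) hs ts)
    in map′ (λ p → ↭-trans (↭-prep x p) (↭-sym ys↭))
            (λ p → drop-∷ (↭-trans p ys↭))
            (xs ↭? (hs ++ ts))

  multisets : DecSetoid a (a ⊔ ℓ)
  multisets = record
    { isDecEquivalence = record
      { isEquivalence = ↭-isEquivalence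
      ; _≟_           = _↭?_
      }
    }

ℕ⁺ : Set
ℕ⁺ = [ n ∈ ℕ ∣ NonZero n ]

Item : Set
Item = ℕ⁺

Bunch : Set
Bunch = List Item

Configuration : Set
Configuration = List Bunch

module Items   = Multiset (decSetoid (≟-by ℕ._≟_ {P = NonZero}))
module Bunches = Multiset Items.multisets

open Items public using () renaming (_↭_ to _≈ᵇ_; _∖_ to _∖ᵇ_)
open Bunches public using () renaming (_↭_ to _≈ᶜ_; _∖_ to _∖ᶜ_)

volume : Bunch → ℕ
volume B = sum (map value B)

LegalBunch : ℕ⁺ → Bunch → Set
LegalBunch κ B = volume B ≤ value κ

Legal : ℕ⁺ → Configuration → Set
Legal κ = All (LegalBunch κ)

underlying : Configuration → List Item
underlying = concat

record Adjacent (κ : ℕ⁺) (C D : Configuration) : Set where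
  field
    legalˡ      : Legal κ C
    legalʳ      : Legal κ D
    donor       : Bunch
    recipient   : Bunch
    donor′      : Bunch
    recipient′  : Bunch
    C∖D         : (C ∖ᶜ D) ≈ᶜ (donor ∷ recipient ∷ [])
    D∖C         : (D ∖ᶜ C) ≈ᶜ (donor′ ∷ recipient′ ∷ [])
    item        : Item
    item∈donor  : item ∈ donor
    donor-loses : donor′ ≈ᵇ (donor ∖ᵇ [ item ])
    recip-gains : recipient′ ≈ᵇ (item ∷ recipient)

Part : Set
Part = List Item × ℕ⁺

Partition : Set
Partition = List Part

_PartitionOf_ : Partition → List Item → Set
P PartitionOf U = concat (map proj₁ P) ≈ᵇ U

Bounded : ℕ⁺ → Partition → Set
Bounded β = All λ (_ , βᵢ) → value βᵢ ≤ value β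

record IsPortion (κ : ℕ⁺) (part : Part) (𝒜 : Configuration) : Set where
  field
    items : underlying 𝒜 ≈ᵇ proj₁ part
    size  : length 𝒜 ≡ value (proj₂ part)
    legal : Legal κ 𝒜

record Assignment (κ : ℕ⁺) (P : Partition) : Set where
  field
    portion   : Fin (length P) → Configuration
    isPortion : ∀ i → IsPortion κ (lookup P i) (portion i)

open Assignment public

_ConsistentWith_ : ∀ {κ P} → Assignment κ P → Configuration → Set
A ConsistentWith C = concat (tabulate (portion A)) ≈ᶜ C

AdjacentAssignments : ∀ {κ P} → Assignment κ P → Assignment κ P → Set
AdjacentAssignments {κ} A A′ = ∃! _≡_ λ j →
  Adjacent κ (portion A j) (portion A′ j) ×
  (∀ i → i ≢ j → portion A i ≈ᶜ portion A′ i)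

record ConformingSequence (κ : ℕ⁺) (P : Partition) (C-S C-T : Configuration) : Set where
  field
    first            : Assignment κ P
    last             : Assignment κ P
    first-consistent : first ConsistentWith C-S
    last-consistent  : last ConsistentWith C-T
    sequence         : Star AdjacentAssignments first last

Repacking : (β κ : ℕ⁺) (C-S C-T : Configuration) → Set
Repacking β κ C-S C-T = ∃ λ P →
  P PartitionOf underlying C-S × Bounded β P × ConformingSequence κ P C-S C-T

Listing : Set
Listing = List (Bunch × ℕ⁺)

-- L lists every bunch type that occurs in C exactly once, in any order,
-- with its multiplicity in C.
record _Lists_ (L : Listing) (C : Configuration) : Set where
  field
    distinct : AllPairs (λ (B , _) (B′ , _) → ¬ (B ≈ᵇ B′)) L
    contents : concatMap (λ (B , m) → replicate (value m) B) L ≈ᶜ C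

-- Identifiers for the finitely many bunch types of volume at most κ.  The
-- values of ident on other bunches play no role.
record Identifiers (κ : ℕ⁺) : Set where
  field
    ident  : Bunch → ℕ
    unique : ∀ {B B′} → LegalBunch κ B → LegalBunch κ B′ →
             (ident B ≡ ident B′) ⇔ (B ≈ᵇ B′)

data Symbol : Set where
  bit   : Bit → Symbol
  comma : Symbol
  semi  : Symbol
  hash  : Symbol

-- Most significant bit first, without leading zeros (0 is written "0").
binary : ℕ → List Symbol
binary n = map bit (reverse (proj₁ (toDigits 2 n)))

module _ {κ : ℕ⁺} (I : Identifiers κ) where
  open Identifiers I

  encodePair : Bunch × ℕ⁺ → List Symbol
  encodePair (B , m) = binary (ident B) ++ [ comma ] ++ binary (value m) ++ [ semi ]

  encodeListing : Listing → List Symbol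
  encodeListing L = concatMap encodePair L ++ [ hash ]

  encode : Listing → Listing → List Symbol
  encode L-S L-T = encodeListing L-S ++ encodeListing L-T

Finite : Set → Set
Finite A = ∃ λ n → A ↔ Fin n

data Move : Set where
  left stay right : Move

record Machine (Input : Set) : Set₁ where
  field
    State        : Set
    Work         : Set
    state-finite : Finite State
    work-finite  : Finite Work

  -- nothing is the blank.
  Cell : Set
  Cell = Maybe (Input ⊎ Work)

  field
    workTapes : ℕ
    start     : State
    verdict   : State → Maybe Bool
    δ         : State → Vec Cell (suc workTapes) →
                State × Vec (Cell × Move) (suc workTapes)

-- A two-way infinite tape: the cells to the left of the head (nearest
-- first), the scanned cell, and the cells to its right (nearest first).
-- All cells not listed are blank.
record Tape (X : Set) : Set where
  constructor tape
  field
    before  : List (Maybe X)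
    scanned : Maybe X
    after   : List (Maybe X)

module _ {X : Set} where

  load : List (Maybe X) → Tape X
  load []       = tape [] nothing []
  load (x ∷ xs) = tape [] x xs

  shift : Move → Tape X → Tape X
  shift left  (tape []       x rs)       = tape [] nothing (x ∷ rs)
  shift left  (tape (l ∷ ls) x rs)       = tape ls l (x ∷ rs)
  shift stay  t                          = t
  shift right (tape ls       x [])       = tape (x ∷ ls) nothing []
  shift right (tape ls       x (r ∷ rs)) = tape (x ∷ ls) r rs

  act : Maybe X × Move → Tape X → Tape X
  act (x , d) t = shift d (record t { scanned = x })

module _ {Input : Set} (M : Machine Input) where
  open Machine M

  Snapshot : Set
  Snapshot = State × Vec (Tape (Input ⊎ Work)) (suc workTapes)

  initial : List Input → Snapshot
  initial w = start , load (map (just ∘ inj₁) w) ∷ Vec.replicate workTapes (load [])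

  step : Snapshot → Snapshot
  step (q , ts) =
    let q′ , actions = δ q (Vec.map Tape.scanned ts)
    in q′ , Vec.zipWith act actions ts

  -- The verdict reached after at most the given number of steps, if any.
  run : ℕ → Snapshot → Maybe Bool
  run n s@(q , _) with verdict q
  ... | just b  = just b
  run zero    s | nothing = nothing
  run (suc n) s | nothing = run n (step s)

  -- On input w, M halts within n steps and accepts exactly if Q holds.
  Answers : ℕ → List Input → Set → Set
  Answers n w Q = ∃ λ b → run n (initial w) ≡ just b × (b ≡ true ⇔ Q)

{-# OPTIONS --safe #-}

-- Only finitely many bunches are legal, so a configuration is a vector of
-- multiplicities indexed by identifiers.  An instance is solvable exactly if
-- the pair (source, target) is a sum of pairs taken from the finite set G of
-- pairs of configurations of at most β bunches that are joined by a
-- reconfiguration sequence: each part of a partition contributes one such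
-- pair, and parts can be reconfigured one after the other.  Membership in
-- the monoid generated by a fixed finite set of vectors is decided by a
-- finite automaton that reads all coordinates in parallel, least significant
-- digit first, and keeps a bounded carry.  A Turing machine with one work
-- tape per side and identifier copies each multiplicity to its tape, which
-- leaves every head just right of the least significant digit, and then runs
-- the automaton while all heads move left.
module Submission where

open import Defs
open import Data.Bool.Base using (Bool; true; false; if_then_else_; _∧_)
open import Data.Digit using (Bit; fromDigits; toDigits)
open import Data.Fin.Base using (Fin; zero; suc; toℕ; fromℕ<; finToFun; funToFin; quotient; remainder; combine)
open import Data.Fin.Patterns using (0F; 1F)
open import Data.Fin.Properties as Fin
  using (finToFun-funToFin; toℕ-fromℕ<; toℕ≤pred[n]; 2↔Bool; *↔×; +↔⊎; remQuot-combine)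
open import Data.Irrelevant using () renaming ([_] to irrelevantly)
open import Data.List.Base
  using (List; []; _∷_; [_]; _++_; _ʳ++_; map; concat; concatMap; length; lookup; reverse; drop;
         replicate; tabulate; filter; cartesianProduct; cartesianProductWith)
open import Data.List.Membership.Propositional using (_∈_; find; lose)
open import Data.List.Membership.Propositional.Properties
  using (∈-lookup; ∈-map⁺; ∈-tabulate⁺; ∈-filter⁺; ∈-filter⁻; ∈-cartesianProduct⁺; ∈-cartesianProductWith⁺)
open import Data.List.Properties
  using (++-assoc; ++-identityʳ; concat-++; unfold-reverse; map-++; length-++; length-map;
         length-reverse; length-ʳ++; ++-ʳ++)
open import Data.List.Relation.Binary.Permutation.Homogeneous using (refl; prep; swap) renaming (trans to ↭-trans)
open import Data.List.Relation.Binary.Permutation.Propositional using (↭ₛ⇒↭)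
import Data.List.Relation.Binary.Permutation.Propositional.Properties as ↭ₚ
import Data.List.Relation.Binary.Permutation.Setoid as Permutation
import Data.List.Relation.Binary.Permutation.Setoid.Properties as Permutationₚ
open import Data.List.Relation.Binary.Pointwise using ([]; _∷_)
open import Data.List.Relation.Unary.All as All using (All; []; _∷_)
import Data.List.Relation.Unary.All.Properties as All
open import Data.List.Relation.Unary.AllPairs using (AllPairs; []; _∷_)
open import Data.List.Relation.Unary.Any using (Any; here; there; index; any?)
open import Data.List.Relation.Unary.Any.Properties using (lookup-index)
open import Data.Maybe.Base using (Maybe; just; nothing)
open import Data.Nat.Base
  using (ℕ; zero; suc; _+_; _*_; _∸_; _^_; _/_; _%_; _≤_; _<_; z≤n; s≤s; NonZero; >-nonZero; >-nonZero⁻¹)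
open import Data.Nat.DivMod
  using (_mod_; m≡m%n+[m/n]*n; [m+kn]%n≡m%n; m<n⇒m%n≡m; m%n<n; /-monoˡ-≤; m*n/n≡m)
import Data.Nat.ListAction as List
open import Data.Nat.ListAction.Properties using (sum-↭)
import Data.Nat.Properties as ℕ
open import Data.Nat.Tactic.RingSolver using (solve-∀)
open import Data.Product.Base using (∃; ∃₂; Σ-syntax; _×_; _,_; proj₁; proj₂)
open import Data.Refinement using (value) renaming (_,_ to _﹐_; _≟_ to ≟-by)
open import Data.Refinement.Properties using (value-injective)
open import Data.Sum.Base using (_⊎_; inj₁; inj₂)
open import Data.Sum.Function.Propositional using (_⊎-↔_)
open import Data.Vec.Base as Vec using (Vec; []; _∷_)
open import Data.Vec.Functional using (updateAt)
open import Data.Vec.Properties using (lookup-map; lookup∘tabulate; tabulate-cong)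
open import Function.Base using (_∘_)
open import Function.Bundles using (_⇔_; mk⇔; Equivalence)
open import Function.Construct.Composition using (_⇔-∘_)
open import Function.Construct.Symmetry using (⇔-sym)
open import Function.Properties.Inverse using (↔-refl; ↔-sym; ↔-trans)
open import Relation.Binary.Bundles using (DecSetoid)
open import Relation.Binary.Construct.Closure.ReflexiveTransitive as Star using (Star; ε; _◅_; _◅◅_)
open import Relation.Binary.Definitions using (Decidable)
open import Relation.Binary.PropositionalEquality
  using (_≡_; _≢_; _≗_; refl; sym; trans; cong; cong₂; subst; decSetoid; module ≡-Reasoning)
open import Relation.Nullary.Decidable
  using (Dec; yes; no; does; map′; _×-dec_; _⊎-dec_; dec-true; dec-false)
open import Relation.Nullary.Negation using (¬_; contradiction)
open import Algebra.Properties.Semiring.Sum ℕ.+-*-semiring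
  using (sum; sum-cong-≗; *-distribʳ-sum; ∑-distrib-+)

-- A finite automaton for finitely generated monoids of vectors

-- Multiplicities are written in binary, so an instance can have exponentially many bunches in the
-- length of its encoding: neither the parts nor a reconfiguration sequence can be written out in
-- linear time. Only the number of parts that use each generator matters, and these numbers can be
-- just as large. Their binary digits are therefore guessed one position at a time, and the guess is
-- made deterministic by the subset construction on carries. Source and target must be decomposed
-- with the same coefficients. Their multiplicities are thus coordinates of one vector and cannot be
-- tested separately. The generators, the number of coordinates and the automaton depend on `β`, `κ`
-- and the identifiers alone. They are huge but constant, and only the length of the numerals grows
-- with the instance.

private
  variable
    m n d : ℕ

record Recogniser (d : ℕ) (P : (Fin d → ℕ) → Set) : Set₁ where
  field
    size   : ℕ
    start  : Fin size
    next   : Fin size → (Fin d → Bit) → Fin size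
    accept : Fin size → Bool
    Accepts    : Fin size → (Fin d → ℕ) → Set
    at-start   : ∀ {v} → Accepts start v ⇔ P v
    after-next : ∀ {q} (β : Fin d → Bit) {v w} → (∀ i → v i ≡ toℕ (β i) + w i * 2) →
                 Accepts q v ⇔ Accepts (next q β) w
    at-zero    : ∀ {q v} → (∀ i → v i ≡ 0) → accept q ≡ true ⇔ Accepts q v

sum-bounded : ∀ {f : Fin n → ℕ} {b} → (∀ i → f i ≤ b) → sum f ≤ n * b
sum-bounded {zero}  f≤b = z≤n
sum-bounded {suc n} f≤b = ℕ.+-mono-≤ (f≤b zero) (sum-bounded (f≤b ∘ suc))

combination : (Fin n → Fin d → ℕ) → (Fin n → ℕ) → Fin d → ℕ
combination g x i = sum λ j → x j * g j i

combination-cong : ∀ (g : Fin n → Fin d → ℕ) {x y} → x ≗ y → combination g x ≗ combination g y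
combination-cong g x≗y i = sum-cong-≗ λ j → cong (_* g j i) (x≗y j)

combination-double : ∀ (g : Fin n → Fin d → ℕ) y z i →
  combination g (λ j → y j + z j * 2) i ≡ combination g y i + combination g z i * 2
combination-double {n} g y z i = begin
  sum (λ j → (y j + z j * 2) * g j i)
    ≡⟨ sum-cong-≗ (λ j → expand (y j) (z j) (g j i)) ⟩
  sum (λ j → y j * g j i + z j * g j i * 2)
    ≡⟨ ∑-distrib-+ (λ j → y j * g j i) (λ j → z j * g j i * 2) ⟩
  combination g y i + sum (λ j → z j * g j i * 2)
    ≡⟨ cong (combination g y i +_) (*-distribʳ-sum 2 (λ j → z j * g j i)) ⟨
  combination g y i + combination g z i * 2 ∎
  where
  open ≡-Reasoning
  expand : ∀ a b c → (a + b * 2) * c ≡ a * c + b * c * 2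
  expand = solve-∀

-- Both doubled terms vanish modulo 2, so `b` is the parity of `s`.
digit-of-sum : ∀ s y (b : Bit) w → s + y * 2 ≡ toℕ b + w * 2 → s ≡ toℕ b + s / 2 * 2
digit-of-sum s y b w eq = begin
  s                    ≡⟨ m≡m%n+[m/n]*n s 2 ⟩
  s % 2 + s / 2 * 2    ≡⟨ cong (_+ s / 2 * 2) s%2 ⟩
  toℕ b + s / 2 * 2    ∎
  where
  open ≡-Reasoning
  s%2 : s % 2 ≡ toℕ b
  s%2 = begin
    s % 2                 ≡⟨ [m+kn]%n≡m%n s y 2 ⟨
    (s + y * 2) % 2       ≡⟨ cong (_% 2) eq ⟩
    (toℕ b + w * 2) % 2   ≡⟨ [m+kn]%n≡m%n (toℕ b) w 2 ⟩
    toℕ b % 2             ≡⟨ m<n⇒m%n≡m (Fin.toℕ<n b) ⟩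
    toℕ b                 ∎

quotient-of-sum : ∀ {s y t} (b : Bit) {w} → s + y * 2 ≡ toℕ b + w * 2 → s ≡ toℕ b + t * 2 → t + y ≡ w
quotient-of-sum {s} {y} {t} b {w} eq refl = ℕ.*-cancelʳ-≡ (t + y) w 2 (ℕ.+-cancelˡ-≡ (toℕ b) _ _ (begin
  toℕ b + (t + y) * 2       ≡⟨ cong (toℕ b +_) (ℕ.*-distribʳ-+ 2 t y) ⟩
  toℕ b + (t * 2 + y * 2)   ≡⟨ ℕ.+-assoc (toℕ b) (t * 2) (y * 2) ⟨
  toℕ b + t * 2 + y * 2     ≡⟨ eq ⟩
  toℕ b + w * 2             ∎))
  where open ≡-Reasoning

indicator : {A : Set} → Dec A → Bit
indicator a? = if does a? then 1F else 0F

indicator-⇔ : {A : Set} (a? : Dec A) → indicator a? ≡ 1F ⇔ A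
indicator-⇔ (yes a) = mk⇔ (λ _ → a) (λ _ → refl)
indicator-⇔ (no ¬a) = mk⇔ (λ ()) (λ a → contradiction a ¬a)

-- Numbers are read least significant digit first.  Writing a coefficient
-- vector as y + 2z with y ∈ {0,1}ⁿ turns "carry c plus combination x equals
-- β + 2w" into "c + combination y = β + 2c′ and c′ plus combination z equals
-- w"; a carry never exceeds n * bound.  States are sets of possible carries,
-- encoded by their characteristic functions.
module CarryAutomaton (g : Fin n → Fin d → ℕ) (bound : ℕ) (g≤bound : ∀ j i → g j i ≤ bound) where

  base : ℕ
  base = suc (n * bound)

  carry : Fin (base ^ d) → Fin d → ℕ
  carry c i = toℕ (finToFun {base} {d} c i)

  carry-bounded : ∀ c i → carry c i ≤ n * bound
  carry-bounded c i = toℕ≤pred[n] (finToFun {base} {d} c i)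

  carry-surjective : (f : Fin d → ℕ) → (∀ i → f i ≤ n * bound) → ∃ λ c → carry c ≗ f
  carry-surjective f f≤ = funToFin f′ , λ i →
    trans (cong toℕ (finToFun-funToFin f′ i)) (toℕ-fromℕ< (s≤s (f≤ i)))
    where
    f′ : Fin d → Fin base
    f′ i = fromℕ< (s≤s (f≤ i))

  digits : Fin (2 ^ n) → Fin n → ℕ
  digits b j = toℕ (finToFun {2} {n} b j)

  digits-surjective : (f : Fin n → Bit) → ∃ λ b → digits b ≗ toℕ ∘ f
  digits-surjective f = funToFin f , λ j → cong toℕ (finToFun-funToFin f j)

  digits-combination-bounded : ∀ b i → combination g (digits b) i ≤ n * bound
  digits-combination-bounded b i = sum-bounded λ j → ℕ.≤-trans
    (ℕ.*-mono-≤ (toℕ≤pred[n] (finToFun {2} {n} b j)) (g≤bound j i))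
    (ℕ.≤-reflexive (ℕ.*-identityˡ bound))

  member : Fin (2 ^ (base ^ d)) → Fin (base ^ d) → Bit
  member = finToFun {2} {base ^ d}

  comprehension : {A : Fin (base ^ d) → Set} → (∀ c → Dec (A c)) → Fin (2 ^ (base ^ d))
  comprehension A? = funToFin λ c → indicator (A? c)

  member-comprehension : {A : Fin (base ^ d) → Set} (A? : ∀ c → Dec (A c)) (c : Fin (base ^ d)) →
                         member (comprehension A?) c ≡ 1F ⇔ A c
  member-comprehension {A} A? c =
    subst (λ b → b ≡ 1F ⇔ A c) (sym (finToFun-funToFin (λ c → indicator (A? c)) c)) (indicator-⇔ (A? c))

  Null : Fin (base ^ d) → Set
  Null c = ∀ i → carry c i ≡ 0

  null? : ∀ c → Dec (Null c)
  null? c = Fin.all? λ i → carry c i ℕ.≟ 0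

  Transition : (Fin d → Bit) → Fin (base ^ d) → Fin (2 ^ n) → Fin (base ^ d) → Set
  Transition β c b c′ = ∀ i → carry c i + combination g (digits b) i ≡ toℕ (β i) + carry c′ i * 2

  Successor : Fin (2 ^ (base ^ d)) → (Fin d → Bit) → Fin (base ^ d) → Set
  Successor q β c′ = ∃₂ λ c b → member q c ≡ 1F × Transition β c b c′

  successor? : ∀ q β c′ → Dec (Successor q β c′)
  successor? q β c′ = Fin.any? λ c → Fin.any? λ b →
    (member q c Fin.≟ 1F) ×-dec Fin.all? (λ i → _ ℕ.≟ _)

  accepting? : ∀ q → Dec (∃ λ c → member q c ≡ 1F × Null c)
  accepting? q = Fin.any? λ c → (member q c Fin.≟ 1F) ×-dec null? c

  -- The coefficients stay existentially quantified, as only their low digits have been guessed.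
  -- Keeping every carry that some guess produces is what makes the automaton deterministic.
  Reaches : Fin (2 ^ (base ^ d)) → (Fin d → ℕ) → Set
  Reaches q v = ∃₂ λ c x → member q c ≡ 1F × (∀ i → carry c i + combination g x i ≡ v i)

  start : Fin (2 ^ (base ^ d))
  start = comprehension null?

  next : Fin (2 ^ (base ^ d)) → (Fin d → Bit) → Fin (2 ^ (base ^ d))
  next q β = comprehension (successor? q β)

  reaches-start : ∀ {v} → Reaches start v ⇔ ∃ λ x → combination g x ≗ v
  reaches-start = mk⇔
    (λ (c , x , c∈ , eq) → x , λ i →
      trans (cong (_+ combination g x i) (sym (to (member-comprehension null? c) c∈ i))) (eq i))
    (λ (x , eq) → let c , c≗0 = carry-surjective (λ _ → 0) (λ _ → z≤n) in
      c , x , from (member-comprehension null? c) c≗0 ,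
      λ i → trans (cong (_+ combination g x i) (c≗0 i)) (eq i))
    where open Equivalence

  reaches-next : ∀ {q} (β : Fin d → Bit) {v w} → (∀ i → v i ≡ toℕ (β i) + w i * 2) →
                 Reaches q v ⇔ Reaches (next q β) w
  reaches-next {q} β {v} {w} v≗ = mk⇔ forward backward
    where
    open Equivalence

    forward : Reaches q v → Reaches (next q β) w
    forward (c , x , c∈ , eq) = c′ , z , from (member-comprehension (successor? q β) c′) (c , b , c∈ , transition) ,
      λ i → quotient-of-sum {y = combination g z i} {t = carry c′ i} (β i) (total i) (transition i)
      where
      z : Fin n → ℕ
      z j = x j / 2
      b = proj₁ (digits-surjective (λ j → x j mod 2))
      x≗ : x ≗ λ j → digits b j + z j * 2
      x≗ j = begin
        x j                           ≡⟨ m≡m%n+[m/n]*n (x j) 2 ⟩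
        x j % 2 + z j * 2             ≡⟨ cong (_+ z j * 2) (toℕ-fromℕ< (m%n<n (x j) 2)) ⟨
        toℕ (x j mod 2) + z j * 2     ≡⟨ cong (_+ z j * 2) (proj₂ (digits-surjective (λ j → x j mod 2)) j) ⟨
        digits b j + z j * 2          ∎
        where open ≡-Reasoning
      s : Fin d → ℕ
      s i = carry c i + combination g (digits b) i
      total : ∀ i → s i + combination g z i * 2 ≡ toℕ (β i) + w i * 2
      total i = begin
        s i + combination g z i * 2
          ≡⟨ ℕ.+-assoc (carry c i) (combination g (digits b) i) (combination g z i * 2) ⟩
        carry c i + (combination g (digits b) i + combination g z i * 2)
          ≡⟨ cong (carry c i +_) (combination-double g (digits b) z i) ⟨
        carry c i + combination g (λ j → digits b j + z j * 2) i
          ≡⟨ cong (carry c i +_) (combination-cong g x≗ i) ⟨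
        carry c i + combination g x i
          ≡⟨ eq i ⟩
        v i
          ≡⟨ v≗ i ⟩
        toℕ (β i) + w i * 2 ∎
        where open ≡-Reasoning
      -- This is the origin of the bound on carries: a carry and a digit combination, each at most
      -- `n * bound`, add up to at most twice that, and halving restores the bound.
      half-bounded : ∀ i → s i / 2 ≤ n * bound
      half-bounded i = begin
        s i / 2                      ≤⟨ /-monoˡ-≤ 2 (ℕ.+-mono-≤ (carry-bounded c i) (digits-combination-bounded b i)) ⟩
        (n * bound + n * bound) / 2  ≡⟨ cong (_/ 2) (double (n * bound)) ⟩
        n * bound * 2 / 2            ≡⟨ m*n/n≡m (n * bound) 2 ⟩
        n * bound                    ∎
        where
        open ℕ.≤-Reasoning
        double : ∀ k → k + k ≡ k * 2
        double = solve-∀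
      c′ = proj₁ (carry-surjective (λ i → s i / 2) half-bounded)
      transition : Transition β c b c′
      transition i = trans (digit-of-sum (s i) (combination g z i) (β i) (w i) (total i))
        (cong (λ t → toℕ (β i) + t * 2) (sym (proj₂ (carry-surjective (λ i → s i / 2) half-bounded) i)))

    backward : Reaches (next q β) w → Reaches q v
    backward (c′ , z , c′∈ , eq) =
      let c , b , c∈ , transition = to (member-comprehension (successor? q β) c′) c′∈ in
      c , (λ j → digits b j + z j * 2) , c∈ , λ i → begin
        carry c i + combination g (λ j → digits b j + z j * 2) i
          ≡⟨ cong (carry c i +_) (combination-double g (digits b) z i) ⟩
        carry c i + (combination g (digits b) i + combination g z i * 2)
          ≡⟨ ℕ.+-assoc (carry c i) _ _ ⟨
        carry c i + combination g (digits b) i + combination g z i * 2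
          ≡⟨ cong (_+ combination g z i * 2) (transition i) ⟩
        toℕ (β i) + carry c′ i * 2 + combination g z i * 2
          ≡⟨ regroup (toℕ (β i)) (carry c′ i) (combination g z i) ⟩
        toℕ (β i) + (carry c′ i + combination g z i) * 2
          ≡⟨ cong (λ t → toℕ (β i) + t * 2) (eq i) ⟩
        toℕ (β i) + w i * 2
          ≡⟨ v≗ i ⟨
        v i ∎
      where
      open ≡-Reasoning
      regroup : ∀ a b c → a + b * 2 + c * 2 ≡ a + (b + c) * 2
      regroup = solve-∀

  -- A sum of naturals vanishes only if every summand does, which forces a null carry. Conversely,
  -- zero coefficients complete a null carry.
  reaches-zero : ∀ {q v} → (∀ i → v i ≡ 0) → does (accepting? q) ≡ true ⇔ Reaches q v
  reaches-zero {q} {v} v≗0 = mk⇔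
    (λ accepted → let c , c∈ , c≗0 = dec-true⁻¹ (accepting? q) accepted in
      c , (λ _ → 0) , c∈ , λ i → trans (cong₂ _+_ (c≗0 i) (combination-zero i)) (sym (v≗0 i)))
    (λ (c , x , c∈ , eq) → dec-true (accepting? q)
      (c , c∈ , λ i → ℕ.m+n≡0⇒m≡0 (carry c i) (trans (eq i) (v≗0 i))))
    where
    combination-zero : ∀ i → combination g (λ _ → 0) i ≡ 0
    combination-zero i = ℕ.n≤0⇒n≡0 (ℕ.≤-trans (sum-bounded {n} {b = 0} λ _ → z≤n) (ℕ.≤-reflexive (ℕ.*-zeroʳ n)))
    dec-true⁻¹ : {A : Set} (a? : Dec A) → does a? ≡ true → A
    dec-true⁻¹ (yes a) _ = a

  recogniser : Recogniser d λ v → ∃ λ x → combination g x ≗ v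
  recogniser = record
    { size       = 2 ^ (base ^ d)
    ; start      = start
    ; next       = next
    ; accept     = λ q → does (accepting? q)
    ; Accepts    = Reaches
    ; at-start   = reaches-start
    ; after-next = reaches-next
    ; at-zero    = reaches-zero
    }

-- The Turing machine

zipWith-tabulate : ∀ {A B C : Set} (f : A → B → C) (g : Fin n → A) (h : Fin n → B) →
                   Vec.zipWith f (Vec.tabulate g) (Vec.tabulate h) ≡ Vec.tabulate (λ i → f (g i) (h i))
zipWith-tabulate {zero}  f g h = refl
zipWith-tabulate {suc n} f g h = cong (f (g zero) (h zero) ∷_) (zipWith-tabulate f (g ∘ suc) (h ∘ suc))

replicate-tabulate : ∀ {A : Set} n (x : A) → Vec.replicate n x ≡ Vec.tabulate (λ _ → x)
replicate-tabulate zero    x = refl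
replicate-tabulate (suc n) x = cong (x ∷_) (replicate-tabulate n x)

module _ {X : Set} where

  -- The head scans the first cell of the second list.
  rightward : List (Maybe X) → List (Maybe X) → Tape X
  rightward ls []       = tape ls nothing []
  rightward ls (x ∷ xs) = tape ls x xs

  -- The head scans the first cell of the first list, which extends to the left.
  leftward : List (Maybe X) → List (Maybe X) → Tape X
  leftward []       rs = tape [] nothing rs
  leftward (x ∷ ls) rs = tape ls x rs

  shift-right : ∀ ls x xs → shift right (tape ls x xs) ≡ rightward (x ∷ ls) xs
  shift-right ls x []       = refl
  shift-right ls x (_ ∷ xs) = refl

  shift-left : ∀ ls (x : Maybe X) rs → shift left (tape ls x rs) ≡ leftward ls (x ∷ rs)
  shift-left []       x rs = refl
  shift-left (_ ∷ ls) x rs = refl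

  load-rightward : ∀ xs → load xs ≡ rightward [] xs
  load-rightward []       = refl
  load-rightward (x ∷ xs) = refl

numeralOf : ℕ → List Bit
numeralOf n = proj₁ (toDigits 2 n)

bySide : {A : Set} → A → A → Fin 2 → A
bySide x y 0F = x
bySide x y 1F = y

module Addressing (N : ℕ) where

  side : Fin (2 * N) → Fin 2
  side = quotient N

  key : Fin (2 * N) → ℕ
  key i = toℕ (remainder {2} N i)

module Contents {κ : ℕ⁺} (I : Identifiers κ) where
  open Identifiers I

  -- Digits written later lie nearer to the head, hence the rest of the listing comes first.
  collected : Listing → ℕ → List Bit
  collected []            k = []
  collected ((B , m) ∷ L) k = collected L k ++ (if does (k ℕ.≟ ident B) then numeralOf (value m) else [])

module Decider {κ : ℕ⁺} (I : Identifiers κ) (N-1 : ℕ)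
               {P : (Fin (2 * suc N-1) → ℕ) → Set} (R : Recogniser (2 * suc N-1) P) where
  open Identifiers I
  open Contents I
  open Recogniser R renaming (start to start-state)

  N = suc N-1
  D = 2 * N
  open Addressing N

  addressed : Fin 2 → ℕ → Fin D → Bool
  addressed s k i = does (side i Fin.≟ s) ∧ does (key i ℕ.≟ k)

  -- While an identifier or a multiplicity is read, the state stores the side
  -- and the identifier read so far.
  Control : Set
  Control = (Fin 2 × Fin N) ⊎ ((Fin 2 × Fin N) ⊎ (Fin size ⊎ Bool))

  pattern reading s k  = inj₁ (s , k)
  pattern copying s k  = inj₂ (inj₁ (s , k))
  pattern sweeping q   = inj₂ (inj₂ (inj₁ q))
  pattern finished b   = inj₂ (inj₂ (inj₂ b))

  ⊎-finite : ∀ {A B : Set} → Finite A → Finite B → Finite (A ⊎ B)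
  ⊎-finite (m , A↔) (n , B↔) = m + n , ↔-trans (A↔ ⊎-↔ B↔) (↔-sym +↔⊎)

  control-finite : Finite Control
  control-finite = ⊎-finite address (⊎-finite address (⊎-finite (size , ↔-refl) (2 , ↔-sym 2↔Bool)))
    where
    address : Finite (Fin 2 × Fin N)
    address = D , ↔-sym *↔×

  Content : Set
  Content = Maybe (Symbol ⊎ Fin 0)

  pattern symbol x = just (inj₁ x)

  -- One Horner step, for digits that arrive most significant first. The fallback keeps the state
  -- space finite; it does not arise while an identifier below `N` is read.
  extend : Fin N → Bit → Fin N
  extend k b with toℕ b + toℕ k * 2 ℕ.<? N
  ... | yes <N = fromℕ< <N
  ... | no  _  = k

  -- A blank counts as 0, which pads numerals of different lengths with leading zeros.
  digit : Content → Bit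
  digit (symbol (bit b)) = b
  digit _                = 0F

  WorkActions : Set
  WorkActions = Fin D → Content → Content × Move

  all-tapes : Move → WorkActions
  all-tapes move _ c = c , move

  write-bit : Fin 2 → ℕ → Bit → WorkActions
  write-bit s k b i c = if addressed s k i then (symbol (bit b) , right) else (c , stay)

  control : Control → Content → (Fin D → Content) → Control × Move × WorkActions
  control (reading s k)  (symbol (bit b)) cs = reading s (extend k b) , right , all-tapes stay
  control (reading s k)  (symbol comma)   cs = copying s k , right , all-tapes stay
  control (reading 0F k) (symbol hash)    cs = reading 1F 0F , right , all-tapes stay
  -- The heads turn together: the work heads step from a blank onto the lowest digits, the input
  -- head off the final `hash`. From here on the input tape serves as a clock.
  control (reading 1F k) (symbol hash)    cs = sweeping start-state , left , all-tapes left
  control (copying s k)  (symbol (bit b)) cs = copying s k , right , write-bit s (toℕ k) b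
  control (copying s k)  (symbol semi)    cs = reading s 0F , right , all-tapes stay
  control (sweeping q)   (just _)         cs = sweeping (next q (digit ∘ cs)) , left , all-tapes left
  -- The input head has left the input on the left. No numeral is longer than the input before the
  -- final `hash`, so every digit has been read.
  control (sweeping q)   nothing          cs = finished (accept q) , stay , all-tapes stay
  control _              _                cs = finished false , stay , all-tapes stay

  verdict : Control → Maybe Bool
  verdict (finished b) = just b
  verdict _            = nothing

  machine : Machine Symbol
  machine = record
    { State        = Control
    ; Work         = Fin 0
    ; state-finite = control-finite
    ; work-finite  = 0 , ↔-refl
    ; workTapes    = D
    ; start        = reading 0F 0F
    ; verdict      = verdict
    ; δ            = λ { q (x ∷ cs) →
        let q′ , move , f = control q x (Vec.lookup cs)
        in q′ , (x , move) ∷ Vec.tabulate (λ i → f i (Vec.lookup cs i)) }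
    }

  -- Quantifying over the remaining time `m` makes stretches compose by adding their lengths and
  -- transfers the verdict backwards.
  record _⟶⟨_⟩_ (σ : Snapshot machine) (n : ℕ) (τ : Snapshot machine) : Set where
    constructor leads
    field
      after : ∀ m → run machine (n + m) σ ≡ run machine m τ
  open _⟶⟨_⟩_

  ⟶-trans : ∀ {σ τ υ m n} → σ ⟶⟨ m ⟩ τ → τ ⟶⟨ n ⟩ υ → σ ⟶⟨ m + n ⟩ υ
  ⟶-trans {σ} {m = m} {n} f g .after k =
    trans (cong (λ l → run machine l σ) (ℕ.+-assoc m n k)) (trans (f .after (n + k)) (g .after k))

  ⟶-step : ∀ {σ τ} → verdict (proj₁ σ) ≡ nothing → step machine σ ≡ τ → σ ⟶⟨ 1 ⟩ τ
  ⟶-step {σ} {τ} running eq .after m with verdict (proj₁ σ)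
  ... | nothing = cong (run machine m) eq

  scanned-tabulate : (ts : Fin D → Tape (Symbol ⊎ Fin 0)) → ∀ i →
                     Vec.lookup (Vec.map Tape.scanned (Vec.tabulate ts)) i ≡ Tape.scanned (ts i)
  scanned-tabulate ts i = trans (lookup-map i Tape.scanned (Vec.tabulate ts)) (cong Tape.scanned (lookup∘tabulate ts i))

  work-step : (f : WorkActions) (ts : Fin D → Tape (Symbol ⊎ Fin 0)) →
    Vec.zipWith act (Vec.tabulate (λ i → f i (Vec.lookup (Vec.map Tape.scanned (Vec.tabulate ts)) i))) (Vec.tabulate ts) ≡
    Vec.tabulate (λ i → act (f i (Tape.scanned (ts i))) (ts i))
  work-step f ts = trans (zipWith-tabulate act (λ i → f i (Vec.lookup (Vec.map Tape.scanned (Vec.tabulate ts)) i)) ts)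
    (tabulate-cong λ i → cong (λ c → act (f i c) (ts i)) (scanned-tabulate ts i))

  cells : List Symbol → List Content
  cells = map (just ∘ inj₁)

  bits : List Bit → List Content
  bits = map (λ b → symbol (bit b))

  -- Least significant bit first, so the head stands to the right of the
  -- binary expansion.
  numeral : List Bit → Tape (Symbol ⊎ Fin 0)
  numeral ds = tape (bits ds) nothing []

  parsing : Control → List Symbol → List Symbol → (Fin D → List Bit) → Snapshot machine
  parsing q u w t = q , rightward (cells u) (cells w) ∷ Vec.tabulate (numeral ∘ t)

  -- The statement holds in every context `u`, `w`, so that such facts concatenate along with the
  -- words read.
  record Consumes (q : Control) (t : Fin D → List Bit) (p : List Symbol)
                  (q′ : Control) (t′ : Fin D → List Bit) : Set where
    constructor consumes
    field
      moves : ∀ u w → parsing q u (p ++ w) t ⟶⟨ length p ⟩ parsing q′ (p ʳ++ u) w t′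
  open Consumes

  consume-none : ∀ {q t} → Consumes q t [] q t
  consume-none .moves u w .after m = refl

  consume-++ : ∀ {q t p q′ t′ p′ q″ t″} → Consumes q t p q′ t′ → Consumes q′ t′ p′ q″ t″ →
               Consumes q t (p ++ p′) q″ t″
  consume-++ {p = p} {p′ = p′} f g .moves u w
    rewrite ++-assoc p p′ w | length-++ p {p′} | ++-ʳ++ p {p′} {u} =
    ⟶-trans (f .moves u (p′ ++ w)) (g .moves (p ʳ++ u) w)

  consume-cong : ∀ {q t p q′ t′ t″} → t′ ≗ t″ → Consumes q t p q′ t′ → Consumes q t p q′ t″
  consume-cong {p = p} {q′} t′≗t″ f .moves u w .after m = trans (f .moves u w .after m)
    (cong (λ ts → run machine m (q′ , rightward (cells (p ʳ++ u)) (cells w) ∷ ts))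
          (tabulate-cong (cong numeral ∘ t′≗t″)))

  consume-one : ∀ {q t q′ t′} x f → verdict q ≡ nothing → (∀ cs → control q (symbol x) cs ≡ (q′ , right , f)) →
                (∀ i → act (f i nothing) (numeral (t i)) ≡ numeral (t′ i)) → Consumes q t [ x ] q′ t′
  consume-one {q} {t} {q′} x f running eq works .moves u w = ⟶-step running (help (eq _))
    where
    ts = Vec.map Tape.scanned (Vec.tabulate (numeral ∘ t))
    help : ∀ {r} → r ≡ (q′ , right , f) →
           (proj₁ r , Vec.zipWith act ((symbol x , proj₁ (proj₂ r)) ∷ Vec.tabulate (λ i → proj₂ (proj₂ r) i (Vec.lookup ts i)))
                                      (rightward (cells u) (cells (x ∷ w)) ∷ Vec.tabulate (numeral ∘ t)))
           ≡ _
    help refl = cong (q′ ,_) (cong₂ _∷_ (shift-right (cells u) (symbol x) (cells w))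
      (trans (work-step f (numeral ∘ t)) (tabulate-cong works)))

  extend-toℕ : ∀ k b → toℕ b + toℕ k * 2 < N → toℕ (extend k b) ≡ toℕ b + toℕ k * 2
  extend-toℕ k b <N with toℕ b + toℕ k * 2 ℕ.<? N
  ... | yes <N′ = toℕ-fromℕ< <N′
  ... | no  ≮N  = contradiction <N ≮N

  -- Induction on the digits, least significant first, peels off the symbol read last. The value of
  -- a prefix is at most that of the whole numeral, so it stays below `N` too.
  read-bits : ∀ s t ds → fromDigits ds < N →
    ∃ λ k → toℕ k ≡ fromDigits ds × Consumes (reading s 0F) t (map bit (reverse ds)) (reading s k) t
  read-bits s t []       _  = 0F , refl , consume-none
  read-bits s t (d ∷ ds) <N
    rewrite unfold-reverse d ds | map-++ bit (reverse ds) [ d ] =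
    let k , k≡ , f = read-bits s t ds (ℕ.≤-<-trans (ℕ.≤-trans (ℕ.m≤m*n (fromDigits ds) 2) (ℕ.m≤n+m _ (toℕ d))) <N)
        k*2≡ = cong (λ v → toℕ d + v * 2) k≡
    in extend k d
     , trans (extend-toℕ k d (subst (_< N) (sym k*2≡) <N)) k*2≡
     , consume-++ f (consume-one (bit d) (all-tapes stay) refl (λ _ → refl) (λ _ → refl))

  push : Fin 2 → ℕ → List Bit → (Fin D → List Bit) → Fin D → List Bit
  push s k ds t i = (if addressed s k i then ds else []) ++ t i

  copy-bits : ∀ s k t ds → Consumes (copying s k) t (map bit (reverse ds)) (copying s k) (push s (toℕ k) ds t)
  copy-bits s k t [] = consume-cong unchanged consume-none
    where
    unchanged : t ≗ push s (toℕ k) [] t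
    unchanged i with addressed s (toℕ k) i
    ... | true  = refl
    ... | false = refl
  copy-bits s k t (d ∷ ds)
    rewrite unfold-reverse d ds | map-++ bit (reverse ds) [ d ] =
    consume-++ (copy-bits s k t ds) (consume-one (bit d) (write-bit s (toℕ k) d) refl (λ _ → refl) written)
    where
    written : ∀ i → act (write-bit s (toℕ k) d i nothing) (numeral (push s (toℕ k) ds t i)) ≡
                    numeral (push s (toℕ k) (d ∷ ds) t i)
    written i with addressed s (toℕ k) i
    ... | true  = refl
    ... | false = refl

  read-pair : ∀ s t B m → ident B < N →
    Consumes (reading s 0F) t (encodePair I (B , m)) (reading s 0F) (push s (ident B) (numeralOf (value m)) t)
  read-pair s t B m <N =
    let ident≡ = proj₂ (toDigits 2 (ident B))
        k , k≡ , f = read-bits s t (numeralOf (ident B)) (subst (_< N) (sym ident≡) <N)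
    in subst (λ l → Consumes (reading s 0F) t (encodePair I (B , m)) (reading s 0F) (push s l (numeralOf (value m)) t))
        (trans k≡ ident≡)
        (consume-++ f
        (consume-++ (consume-one comma (all-tapes stay) refl (λ _ → refl) (λ _ → refl))
        (consume-++ (copy-bits s k t (numeralOf (value m)))
                    (consume-one semi (all-tapes stay) refl (λ _ → refl) (λ _ → refl)))))

  record-listing : Fin 2 → Listing → (Fin D → List Bit) → Fin D → List Bit
  record-listing s L t i = (if does (side i Fin.≟ s) then collected L (key i) else []) ++ t i

  read-listing : ∀ s t L → All (λ (B , _) → ident B < N) L →
    Consumes (reading s 0F) t (concatMap (encodePair I) L) (reading s 0F) (record-listing s L t)
  read-listing s t [] [] = consume-cong unchanged consume-none
    where
    unchanged : t ≗ record-listing s [] t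
    unchanged i with does (side i Fin.≟ s)
    ... | true  = refl
    ... | false = refl
  read-listing s t ((B , m) ∷ L) (<N ∷ <Ns) =
    consume-cong later-on-top (consume-++ (read-pair s t B m <N) (read-listing s _ L <Ns))
    where
    later-on-top : record-listing s L (push s (ident B) (numeralOf (value m)) t) ≗ record-listing s ((B , m) ∷ L) t
    later-on-top i with does (side i Fin.≟ s)
    ... | true  = sym (++-assoc (collected L (key i)) _ (t i))
    ... | false = refl

  contents : Listing → Listing → Fin D → List Bit
  contents L-S L-T i = collected (bySide L-S L-T (side i)) (key i)

  body : Listing → Listing → List Symbol
  body L-S L-T = encodeListing I L-S ++ concatMap (encodePair I) L-T

  encode-body : ∀ L-S L-T → encode I L-S L-T ≡ body L-S L-T ++ [ hash ]
  encode-body L-S L-T = sym (++-assoc (encodeListing I L-S) _ [ hash ])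

  read-body : ∀ L-S L-T → All (λ (B , _) → ident B < N) L-S → All (λ (B , _) → ident B < N) L-T →
    Consumes (reading 0F 0F) (λ _ → []) (body L-S L-T) (reading 1F 0F) (contents L-S L-T)
  read-body L-S L-T S<N T<N = consume-cong by-side
    (consume-++ (consume-++ (read-listing 0F (λ _ → []) L-S S<N)
                            (consume-one hash (all-tapes stay) refl (λ _ → refl) (λ _ → refl)))
                (read-listing 1F _ L-T T<N))
    where
    by-side : record-listing 1F L-T (record-listing 0F L-S (λ _ → [])) ≗ contents L-S L-T
    by-side i with side i
    ... | 0F = ++-identityʳ (collected L-S (key i))
    ... | 1F = ++-identityʳ (collected L-T (key i))

  -- Each block of digits is charged to the pair it was copied from, whose encoding contains these
  -- digits.
  collected-length : ∀ L k → length (collected L k) ≤ length (concatMap (encodePair I) L)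
  collected-length []            k = z≤n
  collected-length ((B , m) ∷ L) k = begin
    length (collected L k ++ top)                        ≡⟨ length-++ (collected L k) ⟩
    length (collected L k) + length top                  ≤⟨ ℕ.+-mono-≤ (collected-length L k) top≤ ⟩
    length rest + length (encodePair I (B , m))          ≡⟨ ℕ.+-comm (length rest) _ ⟩
    length (encodePair I (B , m)) + length rest          ≡⟨ length-++ (encodePair I (B , m)) ⟨
    length (encodePair I (B , m) ++ rest)                ∎
    where
    open ℕ.≤-Reasoning
    rest = concatMap (encodePair I) L
    ds = numeralOf (value m)
    top = if does (k ℕ.≟ ident B) then ds else []
    ds≤ : length ds ≤ length (encodePair I (B , m))
    ds≤ = begin
      length ds                                            ≡⟨ length-reverse ds ⟨
      length (reverse ds)                                  ≡⟨ length-map bit (reverse ds) ⟨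
      length (binary (value m))                            ≤⟨ ℕ.m≤m+n _ 1 ⟩
      length (binary (value m)) + 1                        ≡⟨ length-++ (binary (value m)) ⟨
      length (binary (value m) ++ [ semi ])                ≤⟨ ℕ.m≤n+m _ (suc (length (binary (ident B)))) ⟩
      suc (length (binary (ident B))) + length (binary (value m) ++ [ semi ]) ≡⟨ ℕ.+-suc (length (binary (ident B))) _ ⟨
      length (binary (ident B)) + suc (length (binary (value m) ++ [ semi ])) ≡⟨ length-++ (binary (ident B)) ⟨
      length (encodePair I (B , m))                        ∎
    top≤ : length top ≤ length (encodePair I (B , m))
    top≤ with does (k ℕ.≟ ident B)
    ... | true  = ds≤
    ... | false = z≤n

  contents-length : ∀ L-S L-T i → length (contents L-S L-T i) ≤ length (body L-S L-T)
  contents-length L-S L-T i with side i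
  ... | 0F = ℕ.≤-trans (collected-length L-S (key i)) (ℕ.≤-trans
    (ℕ.≤-trans (ℕ.m≤m+n _ 1) (ℕ.≤-reflexive (sym (length-++ (concatMap (encodePair I) L-S)))))
    (ℕ.≤-trans (ℕ.m≤m+n _ _) (ℕ.≤-reflexive (sym (length-++ (encodeListing I L-S))))))
  ... | 1F = ℕ.≤-trans (collected-length L-T (key i))
    (ℕ.≤-trans (ℕ.m≤n+m _ _) (ℕ.≤-reflexive (sym (length-++ (encodeListing I L-S)))))

  -- Running the automaton on the work tapes

  sweep : (q : Fin size) → List Symbol → List Content →
          (Fin D → List Bit) → (Fin D → List Content) → Snapshot machine
  sweep q u rs t as = sweeping q , leftward (cells u) rs ∷ Vec.tabulate (λ i → leftward (bits (t i)) (as i))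

  lowest : List Bit → Bit
  lowest []      = 0F
  lowest (d ∷ _) = d

  digit-scanned : ∀ ds rs → digit (Tape.scanned (leftward (bits ds) rs)) ≡ lowest ds
  digit-scanned []       rs = refl
  digit-scanned (d ∷ ds) rs = refl

  fromDigits-lowest : ∀ (ds : List Bit) → fromDigits ds ≡ toℕ (lowest ds) + fromDigits (drop 1 ds) * 2
  fromDigits-lowest []       = refl
  fromDigits-lowest (d ∷ ds) = refl

  advance : ∀ ds rs → let T = leftward (bits ds) rs in
            act (Tape.scanned T , left) T ≡ leftward (bits (drop 1 ds)) (Tape.scanned T ∷ rs)
  advance []       rs = refl
  advance (d ∷ ds) rs = shift-left (bits ds) (symbol (bit d)) rs

  column : (Fin D → List Bit) → (Fin D → List Content) → Fin D → Bit
  column t as i = digit (Vec.lookup (Vec.map Tape.scanned (Vec.tabulate (λ j → leftward (bits (t j)) (as j)))) i)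

  -- Induction on the input `u` still to the left, which is at least as long as every remaining
  -- numeral. When it is used up all numerals are empty and `at-zero` applies; the additional step
  -- is the one on the blank beyond the input.
  sweep-decides : ∀ q u rs t as → (∀ i → length (t i) ≤ length u) →
    ∃ λ b → (∀ m → run machine (suc (length u) + m) (sweep q u rs t as) ≡ just b) ×
            (b ≡ true ⇔ Accepts q (fromDigits ∘ t))
  sweep-decides q [] rs t as short =
    accept q , (λ _ → refl) , at-zero λ i → empty (t i) (short i)
    where
    empty : ∀ (ds : List Bit) → length ds ≤ 0 → fromDigits ds ≡ 0
    empty [] _ = refl
  sweep-decides q (x ∷ u) rs t as short =
    let b , decided , correct = sweep-decides (next q β) u (symbol x ∷ rs) t′ as′ shorter
    in b , (λ m → trans (cong (run machine (suc (length u) + m)) stepped) (decided m)) ,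
       ⇔-sym (after-next β value-split) ⇔-∘ correct
    where
    T : Fin D → Tape (Symbol ⊎ Fin 0)
    T i = leftward (bits (t i)) (as i)
    β = column t as
    t′ = drop 1 ∘ t
    as′ : Fin D → List Content
    as′ i = Tape.scanned (T i) ∷ as i
    stepped : step machine (sweep q (x ∷ u) rs t as) ≡ sweep (next q β) u (symbol x ∷ rs) t′ as′
    stepped = cong (sweeping (next q β) ,_) (cong₂ _∷_ (shift-left (cells u) (symbol x) rs)
      (trans (work-step (all-tapes left) T) (tabulate-cong λ i → advance (t i) (as i))))
    value-split : ∀ i → fromDigits (t i) ≡ toℕ (β i) + fromDigits (t′ i) * 2
    value-split i = trans (fromDigits-lowest (t i)) (cong (λ b → toℕ b + fromDigits (t′ i) * 2)
      (sym (trans (cong digit (scanned-tabulate T i)) (digit-scanned (t i) (as i)))))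
    shorter : ∀ i → length (t′ i) ≤ length u
    shorter i = drop-shorter (t i) (short i)
      where
      drop-shorter : ∀ {k} (ds : List Bit) → length ds ≤ suc k → length (drop 1 ds) ≤ k
      drop-shorter []       _         = z≤n
      drop-shorter (_ ∷ ds) (s≤s ≤k) = ≤k

  turn : ∀ u t → parsing (reading 1F 0F) u [ hash ] t ⟶⟨ 1 ⟩ sweep start-state u [ symbol hash ] t (λ _ → [ nothing ])
  turn u t = ⟶-step refl (cong (sweeping start-state ,_) (cong₂ _∷_ (shift-left (cells u) (symbol hash) [])
    (trans (work-step (all-tapes left) (numeral ∘ t)) (tabulate-cong λ i → shift-left (bits (t i)) nothing []))))

  initial-parsing : ∀ w → initial machine w ≡ parsing (reading 0F 0F) [] w (λ _ → [])
  initial-parsing w = cong (reading 0F 0F ,_)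
    (cong₂ _∷_ (load-rightward (cells w)) (replicate-tabulate D (numeral [])))

  decides : ∀ L-S L-T → All (λ (B , _) → ident B < N) L-S → All (λ (B , _) → ident B < N) L-T →
    Answers machine (2 * length (encode I L-S L-T)) (encode I L-S L-T) (P (fromDigits ∘ contents L-S L-T))
  decides L-S L-T S<N T<N rewrite encode-body L-S L-T =
    let b , decided , correct = sweep-decides start-state u [ symbol hash ] t (λ _ → [ nothing ])
          (λ i → subst (length (t i) ≤_) (sym |u|) (contents-length L-S L-T i))
    in b , (begin
      run machine (2 * length (p ++ [ hash ])) (initial machine (p ++ [ hash ]))
        ≡⟨ cong₂ (run machine) time (initial-parsing (p ++ [ hash ])) ⟩
      run machine ((length p + 1) + (suc (length u) + 0)) (parsing (reading 0F 0F) [] (p ++ [ hash ]) (λ _ → []))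
        ≡⟨ ⟶-trans (read-body L-S L-T S<N T<N .moves [] [ hash ]) (turn u t) .after (suc (length u) + 0) ⟩
      run machine (suc (length u) + 0) (sweep start-state u [ symbol hash ] t (λ _ → [ nothing ]))
        ≡⟨ decided 0 ⟩
      just b ∎) , at-start ⇔-∘ correct
    where
    open ≡-Reasoning
    p = body L-S L-T
    u = p ʳ++ []
    t = contents L-S L-T
    |u| : length u ≡ length p
    |u| = trans (length-ʳ++ p) (ℕ.+-identityʳ (length p))
    -- Reading takes one step per symbol of `p`, the turn at `hash` one more, and the sweep
    -- `length p` steps and one on the blank: exactly twice the input length.
    time : 2 * length (p ++ [ hash ]) ≡ (length p + 1) + (suc (length u) + 0)
    time rewrite length-++ p {[ hash ]} | |u| = twice (length p)
      where
      twice : ∀ l → 2 * (l + 1) ≡ (l + 1) + (suc l + 0)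
      twice = solve-∀

-- Multisets of bunches

module ItemLists = Permutation (DecSetoid.setoid (decSetoid (≟-by ℕ._≟_ {P = NonZero})))
module ItemListsₚ = Permutationₚ (DecSetoid.setoid (decSetoid (≟-by ℕ._≟_ {P = NonZero})))
module BunchLists = Permutation (DecSetoid.setoid Items.multisets)
module BunchListsₚ = Permutationₚ (DecSetoid.setoid Items.multisets)

volume-cong : ∀ {B B′} → B ≈ᵇ B′ → volume B ≡ volume B′
volume-cong B≈B′ = sum-↭ (↭ₚ.map⁺ value (↭ₛ⇒↭ B≈B′))

module _ {κ : ℕ⁺} where

  legalBunch-resp : ∀ {B B′} → B ≈ᵇ B′ → LegalBunch κ B → LegalBunch κ B′
  legalBunch-resp B≈B′ = subst (_≤ value κ) (volume-cong B≈B′)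

  legal-resp : ∀ {C D} → C ≈ᶜ D → Legal κ C → Legal κ D
  legal-resp = BunchListsₚ.All-resp-↭ legalBunch-resp

  legal-remove : ∀ B C → Legal κ C → Legal κ (Bunches.remove B C)
  legal-remove B []       []          = []
  legal-remove B (B′ ∷ C) (l ∷ legal) with does (B Items.↭? B′)
  ... | true  = legal
  ... | false = l ∷ legal-remove B C legal

  legal-∖ : ∀ C D → Legal κ C → Legal κ (C ∖ᶜ D)
  legal-∖ C []      legal = legal
  legal-∖ C (B ∷ D) legal = legal-∖ (Bunches.remove B C) D (legal-remove B C legal)

underlying-cong : ∀ {C D} → C ≈ᶜ D → underlying C ≈ᵇ underlying D
underlying-cong (refl [])          = ItemLists.↭-refl
underlying-cong (refl (B≈ ∷ C≋))   = ItemListsₚ.++⁺ B≈ (underlying-cong (refl C≋))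
underlying-cong (prep B≈ C≈)       = ItemListsₚ.++⁺ B≈ (underlying-cong C≈)
underlying-cong {B₁ ∷ B₂ ∷ C} {B₂′ ∷ B₁′ ∷ D} (swap B₁≈ B₂≈ C≈) = begin
  B₁ ++ (B₂ ++ concat C)      ↭⟨ ItemListsₚ.++⁺ B₁≈ (ItemListsₚ.++⁺ B₂≈ (underlying-cong C≈)) ⟩
  B₁′ ++ (B₂′ ++ concat D)    ≡⟨ ++-assoc B₁′ B₂′ (concat D) ⟨
  (B₁′ ++ B₂′) ++ concat D    ↭⟨ ItemListsₚ.++⁺ʳ (concat D) (ItemListsₚ.++-comm B₁′ B₂′) ⟩
  (B₂′ ++ B₁′) ++ concat D    ≡⟨ ++-assoc B₂′ B₁′ (concat D) ⟩
  B₂′ ++ (B₁′ ++ concat D)    ∎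
  where open ItemLists.PermutationReasoning
underlying-cong (↭-trans C≈ D≈) = ItemLists.↭-trans (underlying-cong C≈) (underlying-cong D≈)

-- Multiplicity vectors of configurations

module Counting {κ : ℕ⁺} (I : Identifiers κ) where
  open Identifiers I
  open Equivalence

  weight : ℕ → Bunch → ℕ
  weight k B = if does (k ℕ.≟ ident B) then 1 else 0

  count : ℕ → Configuration → ℕ
  count k []      = 0
  count k (B ∷ C) = weight k B + count k C

  weight-self : ∀ B → weight (ident B) B ≡ 1
  weight-self B = cong (λ b → if b then 1 else 0) (dec-true (ident B ℕ.≟ ident B) refl)

  weight-other : ∀ {k B} → ¬ k ≡ ident B → weight k B ≡ 0
  weight-other {k} {B} k≢ = cong (λ b → if b then 1 else 0) (dec-false (k ℕ.≟ ident B) k≢)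

  weight-cong : ∀ k {B B′} → LegalBunch κ B → B ≈ᵇ B′ → weight k B ≡ weight k B′
  weight-cong k legal B≈ = cong (λ j → if does (k ℕ.≟ j) then 1 else 0)
    (unique legal (legalBunch-resp {κ} B≈ legal) .from B≈)

  count-++ : ∀ k C D → count k (C ++ D) ≡ count k C + count k D
  count-++ k []      D = refl
  count-++ k (B ∷ C) D = trans (cong (weight k B +_) (count-++ k C D)) (sym (ℕ.+-assoc (weight k B) _ _))

  count-replicate : ∀ k m B → count k (replicate m B) ≡ m * weight k B
  count-replicate k zero    B = refl
  count-replicate k (suc m) B = cong (weight k B +_) (count-replicate k m B)

  count≤length : ∀ k C → count k C ≤ length C
  count≤length k []      = z≤n
  count≤length k (B ∷ C) = ℕ.+-mono-≤ weight≤1 (count≤length k C)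
    where
    weight≤1 : weight k B ≤ 1
    weight≤1 with does (k ℕ.≟ ident B)
    ... | true  = ℕ.≤-refl
    ... | false = z≤n

  count-swap : ∀ k B B′ C → count k (B ∷ B′ ∷ C) ≡ count k (B′ ∷ B ∷ C)
  count-swap k B B′ C = begin
    weight k B + (weight k B′ + count k C)   ≡⟨ ℕ.+-assoc (weight k B) _ _ ⟨
    weight k B + weight k B′ + count k C     ≡⟨ cong (_+ count k C) (ℕ.+-comm (weight k B) _) ⟩
    weight k B′ + weight k B + count k C     ≡⟨ ℕ.+-assoc (weight k B′) _ _ ⟩
    weight k B′ + (weight k B + count k C)   ∎
    where open ≡-Reasoning

  count-insert : ∀ k C B D → count k (C ++ B ∷ D) ≡ weight k B + count k (C ++ D)
  count-insert k []       B D = refl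
  count-insert k (B′ ∷ C) B D = trans (cong (weight k B′ +_) (count-insert k C B D)) (count-swap k B′ B (C ++ D))

  count-cong : ∀ k {C D} → Legal κ C → C ≈ᶜ D → count k C ≡ count k D
  count-cong k legal (refl []) = refl
  count-cong k (l ∷ legal) (refl (B≈ ∷ C≋)) = cong₂ _+_ (weight-cong k l B≈) (count-cong k legal (refl C≋))
  count-cong k (l ∷ legal) (prep B≈ C≈) = cong₂ _+_ (weight-cong k l B≈) (count-cong k legal C≈)
  count-cong k (l ∷ l′ ∷ legal) (swap {xs = C} {ys = D} {x = B} {y = B′} B≈ B′≈ C≈) =
    trans (cong₂ _+_ (weight-cong k l B≈) (cong₂ _+_ (weight-cong k l′ B′≈) (count-cong k legal C≈)))
          (count-swap k _ _ D)
  count-cong k legal (↭-trans C≈ D≈) = trans (count-cong k legal C≈) (count-cong k (legal-resp {κ} C≈ legal) D≈)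

  count-positive : ∀ {k n} C → count k C ≡ suc n → ∃₂ λ C₁ B → ∃ λ C₂ → C ≡ C₁ ++ B ∷ C₂ × k ≡ ident B
  count-positive {k} (B ∷ C) eq with k ℕ.≟ ident B
  ... | yes k≡ = [] , B , C , refl , k≡
  ... | no  k≢ =
    let C₁ , B′ , C₂ , C≡ , k≡ = count-positive C (trans (cong (_+ count k C) (sym (weight-other {k} {B} k≢))) eq)
    in B ∷ C₁ , B′ , C₂ , cong (B ∷_) C≡ , k≡

  -- The head of `C` has positive count in `D`, so some bunch of `D` has its identifier. By `unique`
  -- the two bunches are equal, and they can be cancelled. Facts about multisets of legal bunches
  -- thereby become arithmetic.
  count-injective : ∀ {C D} → Legal κ C → Legal κ D →
    (∀ B → LegalBunch κ B → count (ident B) C ≡ count (ident B) D) → C ≈ᶜ D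
  count-injective {[]} {[]} _ _ _ = BunchLists.↭-refl
  count-injective {[]} {B ∷ D} _ (l ∷ _) eq with () ← trans (eq B l) (cong (_+ count (ident B) D) (weight-self B))
  count-injective {B ∷ C} {D} (l ∷ legalC) legalD eq
    with C₁ , B′ , C₂ , refl , B≡B′ ← count-positive D (trans (sym (eq B l)) (cong (_+ count (ident B) C) (weight-self B)))
    = let legalC₁ , l′∷legalC₂ = All.++⁻ C₁ legalD
          l′ , legalC₂ = All.uncons l′∷legalC₂
          B≈B′ = unique l l′ .to B≡B′
          C≈ = count-injective legalC (All.++⁺ legalC₁ legalC₂) λ B″ l″ → ℕ.+-cancelˡ-≡ (weight (ident B″) B) _ _
            (trans (eq B″ l″) (trans (count-insert (ident B″) C₁ B′ C₂)
              (cong (_+ count (ident B″) (C₁ ++ C₂)) (sym (weight-cong (ident B″) l B≈B′)))))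
      in BunchLists.↭-trans (prep B≈B′ C≈) (BunchLists.↭-sym (BunchListsₚ.shift (ItemLists.↭-refl) C₁ C₂))

  count-remove : ∀ k B C → LegalBunch κ B → Legal κ C → count k (Bunches.remove B C) ≡ count k C ∸ weight k B
  count-remove k B []       l []          = sym (ℕ.0∸n≡0 (weight k B))
  count-remove k B (B′ ∷ C) l (l′ ∷ legal) with B Items.↭? B′
  ... | yes B≈ rewrite weight-cong k l B≈ = sym (ℕ.m+n∸m≡n (weight k B′) (count k C))
  ... | no  B≉ with k ℕ.≟ ident B
  ...   | no  k≢ rewrite count-remove k B C l legal | weight-other {k} {B} k≢ = refl
  ...   | yes refl rewrite count-remove k B C l legal | weight-other {ident B} {B′} (B≉ ∘ unique l l′ .to) = refl

  count-∖ : ∀ k C D → Legal κ C → Legal κ D → count k (C ∖ᶜ D) ≡ count k C ∸ count k D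
  count-∖ k C []      legal []        = refl
  count-∖ k C (B ∷ D) legal (l ∷ ls) = begin
    count k (Bunches.remove B C ∖ᶜ D)            ≡⟨ count-∖ k (Bunches.remove B C) D (legal-remove {κ} B C legal) ls ⟩
    count k (Bunches.remove B C) ∸ count k D     ≡⟨ cong (_∸ count k D) (count-remove k B C l legal) ⟩
    count k C ∸ weight k B ∸ count k D           ≡⟨ ℕ.∸-+-assoc (count k C) (weight k B) (count k D) ⟩
    count k C ∸ (weight k B + count k D)         ∎
    where open ≡-Reasoning

  -- Both differences have the same counts, which spares an induction over two permutations.
  ∖-cong : ∀ {C C′ D D′} → Legal κ C → Legal κ D → C ≈ᶜ C′ → D ≈ᶜ D′ → (C ∖ᶜ D) ≈ᶜ (C′ ∖ᶜ D′)
  ∖-cong {C} {C′} {D} {D′} lC lD C≈ D≈ =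
    let lC′ = legal-resp {κ} C≈ lC
        lD′ = legal-resp {κ} D≈ lD
    in count-injective (legal-∖ {κ} C D lC) (legal-∖ {κ} C′ D′ lC′) λ B _ → begin
      count (ident B) (C ∖ᶜ D)                   ≡⟨ count-∖ (ident B) C D lC lD ⟩
      count (ident B) C ∸ count (ident B) D      ≡⟨ cong₂ _∸_ (count-cong (ident B) lC C≈) (count-cong (ident B) lD D≈) ⟩
      count (ident B) C′ ∸ count (ident B) D′    ≡⟨ count-∖ (ident B) C′ D′ lC′ lD′ ⟨
      count (ident B) (C′ ∖ᶜ D′)                 ∎
    where open ≡-Reasoning

  adjacent-respˡ : ∀ {C C′ D} → C ≈ᶜ C′ → Adjacent κ C D → Adjacent κ C′ D
  adjacent-respˡ C≈ adj = record
    { Adjacent adj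
    ; legalˡ = legal-resp {κ} C≈ legalˡ
    ; C∖D = BunchLists.↭-trans (BunchLists.↭-sym (∖-cong legalˡ legalʳ C≈ BunchLists.↭-refl)) C∖D
    ; D∖C = BunchLists.↭-trans (BunchLists.↭-sym (∖-cong legalʳ legalˡ BunchLists.↭-refl C≈)) D∖C
    }
    where open Adjacent adj

  -- Equal configurations have an empty difference, while that of adjacent ones has two bunches.
  -- This yields the uniqueness of the moving index in `AdjacentAssignments`.
  adjacent⇒≉ : ∀ {C D} → Adjacent κ C D → ¬ (C ≈ᶜ D)
  adjacent⇒≉ {C} {D} adj C≈D = BunchListsₚ.¬x∷xs↭[] (BunchLists.↭-trans (BunchLists.↭-sym C∖D) C∖D≈[])
    where
    open Adjacent adj
    C∖D≈[] : (C ∖ᶜ D) ≈ᶜ []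
    C∖D≈[] = count-injective (legal-∖ {κ} C D legalˡ) [] λ B _ →
      trans (count-∖ (ident B) C D legalˡ legalʳ) (ℕ.m≤n⇒m∸n≡0 (ℕ.≤-reflexive (count-cong (ident B) legalˡ C≈D)))

-- Reachability between small configurations

-- The Warshall recursion: Via vs x y is reachability by paths whose
-- intermediate vertices lie in vs.
module Reachability {A : Set} (R : A → A → Set) (R? : Decidable R) where

  Via : List A → A → A → Set
  Via []       x y = R x y
  Via (v ∷ vs) x y = Via vs x y ⊎ (Via vs x v × Via vs v y)

  via? : ∀ vs → Decidable (Via vs)
  via? []       x y = R? x y
  via? (v ∷ vs) x y = via? vs x y ⊎-dec (via? vs x v ×-dec via? vs v y)

  via⇒star : ∀ vs {x y} → Via vs x y → Star R x y
  via⇒star []       r              = r ◅ ε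
  via⇒star (v ∷ vs) (inj₁ p)       = via⇒star vs p
  via⇒star (v ∷ vs) (inj₂ (p , q)) = via⇒star vs p ◅◅ via⇒star vs q

  edge : ∀ vs {x y} → R x y → Via vs x y
  edge []       r = r
  edge (v ∷ vs) r = inj₁ (edge vs r)

  -- If both paths visit the pivot at the head of the list, everything between the two visits is cut
  -- out, including the detour through `v`.
  via-trans : ∀ {vs x y v} → v ∈ vs → Via vs x v → Via vs v y → Via vs x y
  via-trans {_ ∷ vs} (here refl) (inj₁ p)        (inj₁ q)        = inj₂ (p , q)
  via-trans {_ ∷ vs} (here refl) (inj₁ p)        (inj₂ (_ , q))  = inj₂ (p , q)
  via-trans {_ ∷ vs} (here refl) (inj₂ (p , _))  (inj₁ q)        = inj₂ (p , q)
  via-trans {_ ∷ vs} (there v∈)  (inj₁ p)        (inj₁ q)        = inj₁ (via-trans {vs} v∈ p q)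
  via-trans {_ ∷ vs} (there v∈)  (inj₁ p)        (inj₂ (q , q′)) = inj₂ (via-trans {vs} v∈ p q , q′)
  via-trans {_ ∷ vs} (there v∈)  (inj₂ (p , p′)) (inj₁ q)        = inj₂ (p , via-trans {vs} v∈ p′ q)
  via-trans {_ ∷ vs} _           (inj₂ (p , _))  (inj₂ (_ , q))  = inj₂ (p , q)

  -- `Via` always uses at least one edge; the loops `R x x` and `R y y` account for the empty path.
  star⇒via : ∀ vs → (∀ {x y} → R x y → y ∈ vs × R y y) →
             ∀ {x y} → R x x → Star R x y → Via vs x y
  star⇒via vs closed r ε        = edge vs r
  star⇒via vs closed r (r′ ◅ p) =
    let y∈ , ry = closed r′ in via-trans {vs} y∈ (edge vs r′) (star⇒via vs closed ry p)

  star? : ∀ vs → (∀ {x y} → R x y → y ∈ vs × R y y) → ∀ {x y} → R x x → Dec (Star R x y)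
  star? vs closed {x} {y} r = map′ (via⇒star vs) (star⇒via vs closed r) (via? vs x y)

-- Enumeration of the legal bunches

listsUpTo : {A : Set} → ℕ → List A → List (List A)
listsUpTo zero    xs = [ [] ]
listsUpTo (suc n) xs = [] ∷ cartesianProductWith _∷_ xs (listsUpTo n xs)

∈-listsUpTo : ∀ {A : Set} {n} {xs : List A} {ys} → All (_∈ xs) ys → length ys ≤ n → ys ∈ listsUpTo n xs
∈-listsUpTo {n = zero}  []        _        = here refl
∈-listsUpTo {n = suc n} []        _        = here refl
∈-listsUpTo {n = suc n} (y∈ ∷ ys) (s≤s ≤n) = there (∈-cartesianProductWith⁺ _∷_ y∈ (∈-listsUpTo ys ≤n))

positive : (n : ℕ⁺) → 0 < value n
positive (n ﹐ irrelevantly n≢0) = >-nonZero⁻¹ n {{n≢0}}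

positiveℕ : ∀ n → 0 < n → ℕ⁺
positiveℕ n 0<n = n ﹐ irrelevantly (>-nonZero 0<n)

itemsUpTo : ℕ → List Item
itemsUpTo n = tabulate {n = n} λ i → suc (toℕ i) ﹐ irrelevantly _

∈-itemsUpTo : ∀ {n} (u : Item) → value u ≤ n → u ∈ itemsUpTo n
∈-itemsUpTo {n} u ≤n = go u (positive u) ≤n
  where
  go : (u : Item) → 0 < value u → value u ≤ n → u ∈ itemsUpTo n
  go (suc k ﹐ _) _ k<n =
    subst (_∈ itemsUpTo n) (value-injective (cong suc (toℕ-fromℕ< k<n))) (∈-tabulate⁺ (fromℕ< k<n))

bunchesUpTo : ℕ → List Bunch
bunchesUpTo n = listsUpTo n (itemsUpTo n)

-- Items are positive, so the volume bounds both the number of items and each of them.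
∈-bunchesUpTo : ∀ {n} B → volume B ≤ n → B ∈ bunchesUpTo n
∈-bunchesUpTo {n} B ≤n = ∈-listsUpTo (All.tabulate λ {u} u∈ → ∈-itemsUpTo u (ℕ.≤-trans (value≤volume u∈) ≤n))
                                 (ℕ.≤-trans (length≤volume B) ≤n)
  where
  value≤volume : ∀ {u B} → u ∈ B → value u ≤ volume B
  value≤volume (here refl) = ℕ.m≤m+n _ _
  value≤volume (there u∈)  = ℕ.≤-trans (value≤volume u∈) (ℕ.m≤n+m _ _)
  length≤volume : ∀ B → length B ≤ volume B
  length≤volume []      = z≤n
  length≤volume (u ∷ B) = ℕ.+-mono-≤ (positive u) (length≤volume B)

-- Decidability of adjacency and the finite set of generators

module Linking (β κ : ℕ⁺) where

  legal? : ∀ C → Dec (Legal κ C)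
  legal? = All.all? λ B → volume B ℕ.≤? value κ

  -- Up to ≈ᵇ the bunches of an adjacency can be taken from a finite list, and
  -- the two new ones are determined by the old ones and the item.
  Moves : Configuration → Configuration → Bunch → Bunch → Item → Set
  Moves C D Bd Br u =
    (C ∖ᶜ D) ≈ᶜ (Bd ∷ Br ∷ []) × (D ∖ᶜ C) ≈ᶜ ((Bd ∖ᵇ [ u ]) ∷ (u ∷ Br) ∷ [])

  adjacent? : Decidable (Adjacent κ)
  adjacent? C D = map′ sound complete
    (legal? C ×-dec legal? D ×-dec any? (λ Bd → any? (λ Br → any? (λ u → moves? Bd Br u) Bd) legals) legals)
    where
    legals = bunchesUpTo (value κ)
    moves? : ∀ Bd Br u → Dec (Moves C D Bd Br u)
    moves? Bd Br u = ((C ∖ᶜ D) Bunches.↭? (Bd ∷ Br ∷ [])) ×-dec ((D ∖ᶜ C) Bunches.↭? ((Bd ∖ᵇ [ u ]) ∷ (u ∷ Br) ∷ []))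
    Search : Set
    Search = Any (λ Bd → Any (λ Br → Any (Moves C D Bd Br) Bd) legals) legals
    sound : Legal κ C × Legal κ D × Search → Adjacent κ C D
    sound (lC , lD , found) =
      let Bd , _ , found = find found
          Br , _ , found = find found
          u , u∈ , C∖D , D∖C = find found
      in record
        { legalˡ = lC ; legalʳ = lD ; donor = Bd ; recipient = Br
        ; donor′ = Bd ∖ᵇ [ u ] ; recipient′ = u ∷ Br ; C∖D = C∖D ; D∖C = D∖C
        ; item = u ; item∈donor = u∈
        ; donor-loses = ItemLists.↭-refl ; recip-gains = ItemLists.↭-refl }
    complete : Adjacent κ C D → Legal κ C × Legal κ D × Search
    complete adj = legalˡ , legalʳ ,
      lose (∈-bunchesUpTo donor (All.head legals∖)) (lose (∈-bunchesUpTo recipient (All.head (All.tail legals∖)))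
        (lose item∈donor (C∖D , BunchLists.↭-trans D∖C (prep donor-loses
          (prep recip-gains BunchLists.↭-refl)))))
      where
      open Adjacent adj
      legals∖ : Legal κ (donor ∷ recipient ∷ [])
      legals∖ = legal-resp {κ} C∖D (legal-∖ {κ} C D legalˡ)

  Small : Configuration → Set
  Small C = Legal κ C × length C ≤ value β

  small? : ∀ C → Dec (Small C)
  small? C = legal? C ×-dec (length C ℕ.≤? value β)

  smalls : List Configuration
  smalls = listsUpTo (value β) (bunchesUpTo (value κ))

  ∈-smalls : ∀ {C} → Small C → C ∈ smalls
  ∈-smalls (legal , short) = ∈-listsUpTo (All.map (λ {B} → ∈-bunchesUpTo B) legal) short

  Link : Configuration → Configuration → Set
  Link C D = Small C × Small D × length C ≡ length D × underlying C ≈ᵇ underlying D ×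
             (Adjacent κ C D ⊎ C ≈ᶜ D)

  link? : Decidable Link
  link? C D = small? C ×-dec small? D ×-dec (length C ℕ.≟ length D) ×-dec
              (underlying C Items.↭? underlying D) ×-dec (adjacent? C D ⊎-dec (C Bunches.↭? D))

  link-refl : ∀ {C} → Small C → Link C C
  link-refl small = small , small , refl , ItemLists.↭-refl , inj₂ BunchLists.↭-refl

  open Reachability Link link?

  connected? : ∀ {C D} → Small C → Dec (Star Link C D)
  connected? small = star? smalls (λ (_ , small′ , _) → ∈-smalls small′ , link-refl small′) (link-refl small)

  -- `A` is nonempty because the bound of a part is positive. Smallness is listed separately since
  -- an empty path says nothing about its ends.
  Generator : Configuration × Configuration → Set
  Generator (A , B) = 0 < length A × Small A × Small B × Star Link A B

  generator? : ∀ AB → Dec (Generator AB)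
  generator? (A , B) with small? A
  ... | no  ¬small = no λ (_ , small , _) → ¬small small
  ... | yes small  = map′ (λ (p , q , r) → p , small , q , r) (λ (p , _ , q , r) → p , q , r)
    ((0 ℕ.<? length A) ×-dec small? B ×-dec connected? small)

  generators : List (Configuration × Configuration)
  generators = filter generator? (cartesianProduct smalls smalls)

  ∈-generators : ∀ {AB} → Generator AB → AB ∈ generators
  ∈-generators gen@(_ , smallA , smallB , _) =
    ∈-filter⁺ generator? (∈-cartesianProduct⁺ (∈-smalls smallA) (∈-smalls smallB)) gen

  generators-generate : ∀ j → Generator (lookup generators j)
  generators-generate j = proj₂ (∈-filter⁻ generator? {xs = cartesianProduct smalls smalls} (∈-lookup j))

-- Solvable instances form a monoid

updateAt-sum : ∀ {n} (x : Fin n → ℕ) j (F : Fin n → ℕ) → sum (λ k → updateAt x j suc k * F k) ≡ F j + sum (λ k → x k * F k)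
updateAt-sum {suc n} x zero    F = ℕ.+-assoc (F zero) (x zero * F zero) _
updateAt-sum {suc n} x (suc j) F = begin
  x zero * F zero + sum (λ k → updateAt (x ∘ suc) j suc k * F (suc k))
    ≡⟨ cong (x zero * F zero +_) (updateAt-sum (x ∘ suc) j (F ∘ suc)) ⟩
  x zero * F zero + (F (suc j) + rest)
    ≡⟨ ℕ.+-assoc (x zero * F zero) (F (suc j)) rest ⟨
  x zero * F zero + F (suc j) + rest
    ≡⟨ cong (_+ rest) (ℕ.+-comm (x zero * F zero) (F (suc j))) ⟩
  F (suc j) + x zero * F zero + rest
    ≡⟨ ℕ.+-assoc (F (suc j)) (x zero * F zero) rest ⟩
  F (suc j) + (x zero * F zero + rest) ∎
  where
  open ≡-Reasoning
  rest = sum λ k → x (suc k) * F (suc k)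

-- `x j` is the number of indices that `f` sends to `j`. As `x` is chosen before `F`, one
-- coefficient vector serves all coordinates.
multiplicities : ∀ {m n} (f : Fin m → Fin n) →
  ∃ λ (x : Fin n → ℕ) → (F : Fin n → ℕ) → sum (λ j → x j * F j) ≡ sum (F ∘ f)
multiplicities {zero}  {n} f = (λ _ → 0) , λ F → ℕ.n≤0⇒n≡0
  (ℕ.≤-trans (sum-bounded {n} {b = 0} λ _ → z≤n) (ℕ.≤-reflexive (ℕ.*-zeroʳ n)))
multiplicities {suc m} f =
  let x , x-counts = multiplicities (f ∘ suc)
  in updateAt x (f zero) suc , λ F → trans (updateAt-sum x (f zero) F) (cong (F (f zero) +_) (x-counts F))

portion-resp : ∀ {κ p C D} → C ≈ᶜ D → IsPortion κ p C → IsPortion κ p D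
portion-resp {κ} C≈D isP = record
  { items = ItemLists.↭-trans (ItemLists.↭-sym (underlying-cong C≈D)) items
  ; size  = trans (sym (BunchListsₚ.xs↭ys⇒|xs|≡|ys| C≈D)) size
  ; legal = legal-resp {κ} C≈D legal
  }
  where open IsPortion isP

module Monoid {β κ : ℕ⁺} (I : Identifiers κ) where
  open Identifiers I
  open Counting I
  open Linking β κ

  Portion : Part → Set
  Portion p = ∃ (IsPortion κ p)

  AdjacentPortions : ∀ {p} → Portion p → Portion p → Set
  AdjacentPortions (C , _) (D , _) = Adjacent κ C D

  infixr 5 _∷ᴬ_
  _∷ᴬ_ : ∀ {p P} → Portion p → Assignment κ P → Assignment κ (p ∷ P)
  ((C , isP) ∷ᴬ A) .portion zero      = C
  ((C , isP) ∷ᴬ A) .portion (suc i)   = portion A i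
  ((C , isP) ∷ᴬ A) .isPortion zero    = isP
  ((C , isP) ∷ᴬ A) .isPortion (suc i) = isPortion A i

  adjacent-head : ∀ {p P} {X Y : Portion p} (A : Assignment κ P) →
                  AdjacentPortions X Y → AdjacentAssignments (X ∷ᴬ A) (Y ∷ᴬ A)
  adjacent-head {X = X} {Y} A adj = zero , (adj , others) , only-zero
    where
    others : ∀ i → i ≢ zero → portion (X ∷ᴬ A) i ≈ᶜ portion (Y ∷ᴬ A) i
    others zero    0≢0 = contradiction refl 0≢0
    others (suc i) _   = BunchLists.↭-refl
    only-zero : ∀ {j} → Adjacent κ (portion (X ∷ᴬ A) j) (portion (Y ∷ᴬ A) j) × _ → zero ≡ j
    only-zero {zero}  _         = refl
    only-zero {suc j} (adj , _) = contradiction BunchLists.↭-refl (adjacent⇒≉ adj)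

  adjacent-tail : ∀ {p P} (X : Portion p) {A A′ : Assignment κ P} →
                  AdjacentAssignments A A′ → AdjacentAssignments (X ∷ᴬ A) (X ∷ᴬ A′)
  adjacent-tail X {A} {A′} (j , (adj , others) , only-j) = suc j , (adj , others′) , only-suc-j
    where
    others′ : ∀ i → i ≢ suc j → portion (X ∷ᴬ A) i ≈ᶜ portion (X ∷ᴬ A′) i
    others′ zero    _  = BunchLists.↭-refl
    others′ (suc i) i≢ = others i (i≢ ∘ cong suc)
    only-suc-j : ∀ {i} → Adjacent κ (portion (X ∷ᴬ A) i) (portion (X ∷ᴬ A′) i) ×
                 (∀ k → k ≢ i → portion (X ∷ᴬ A) k ≈ᶜ portion (X ∷ᴬ A′) k) → suc j ≡ i
    only-suc-j {zero}  (adj , _)       = contradiction BunchLists.↭-refl (adjacent⇒≉ adj)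
    only-suc-j {suc i} (adj , others″) = cong suc (only-j (adj , λ k k≢ → others″ (suc k) (k≢ ∘ Fin.suc-injective)))

  -- Steps of a path that replace a portion by an equal one are skipped, so
  -- the path ends in a portion equal to the desired one.
  realise : ∀ {p A B} (X : Portion p) → proj₁ X ≈ᶜ A → Star Link A B →
            Σ[ Y ∈ Portion p ] proj₁ Y ≈ᶜ B × Star AdjacentPortions X Y
  realise X X≈A ε = X , X≈A , ε
  realise X X≈A ((_ , _ , _ , _ , inj₂ A≈A′) ◅ path) = realise X (BunchLists.↭-trans X≈A A≈A′) path
  realise X X≈A (_◅_ {j = A′} (_ , (legal′ , _) , length≡ , underlying≈ , inj₁ adj) path) =
    let open IsPortion (portion-resp X≈A (proj₂ X))
        X′ = A′ , record { items = ItemLists.↭-trans (ItemLists.↭-sym underlying≈) items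
                         ; size = trans (sym length≡) size ; legal = legal′ }
        Y , Y≈B , steps = realise X′ BunchLists.↭-refl path
    in Y , Y≈B , adjacent-respˡ (BunchLists.↭-sym X≈A) adj ◅ steps

  repacking-[] : Repacking β κ [] []
  repacking-[] = [] , ItemLists.↭-refl , [] , record
    { first = empty ; last = empty
    ; first-consistent = BunchLists.↭-refl ; last-consistent = BunchLists.↭-refl ; sequence = ε }
    where
    empty : Assignment κ []
    empty = record { portion = λ () ; isPortion = λ () }

  repacking-++ : ∀ {A B C D} → Generator (A , B) → Repacking β κ C D → Repacking β κ (A ++ C) (B ++ D)
  repacking-++ {A} {B} {C} {D} (0<|A| , (legalA , |A|≤β) , _ , path) (P , partition , bounded , conforming) =
    let Y , Y≈B , steps = realise X BunchLists.↭-refl path in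
    p ∷ P ,
    ItemLists.↭-trans (ItemListsₚ.++⁺ˡ (concat A) partition) (ItemLists.↭-reflexive (concat-++ A C)) ,
    |A|≤β ∷ bounded ,
    record
      { first = X ∷ᴬ first
      ; last = Y ∷ᴬ last
      ; first-consistent = BunchListsₚ.++⁺ˡ A first-consistent
      ; last-consistent = BunchListsₚ.++⁺ Y≈B last-consistent
      -- The new portion moves while the others rest at `first`; then these move while it rests at
      -- `Y`.
      ; sequence = Star.gmap (_∷ᴬ first) (adjacent-head first) steps ◅◅
                   Star.gmap (Y ∷ᴬ_) (adjacent-tail Y) sequence
      }
    where
    open ConformingSequence conforming
    p : Part
    p = underlying A , positiveℕ (length A) 0<|A|
    X : Portion p
    X = A , record { items = ItemLists.↭-refl ; size = refl ; legal = legalA }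

  repacking-resp : ∀ {C C′ D D′} → C ≈ᶜ C′ → D ≈ᶜ D′ → Repacking β κ C D → Repacking β κ C′ D′
  repacking-resp C≈ D≈ (P , partition , bounded , conforming) =
    P , ItemLists.↭-trans partition (underlying-cong C≈) , bounded , record
      { ConformingSequence conforming
      ; first-consistent = BunchLists.↭-trans first-consistent C≈
      ; last-consistent = BunchLists.↭-trans last-consistent D≈ }
    where open ConformingSequence conforming

  -- Only counts are recorded: `count-injective` later identifies the constructed configurations
  -- with the given ones.
  record Packed (u v : ℕ → ℕ) : Set where
    field
      {source target} : Configuration
      source-legal    : Legal κ source
      target-legal    : Legal κ target
      repacking       : Repacking β κ source target
      source-count    : ∀ k → count k source ≡ u k
      target-count    : ∀ k → count k target ≡ v k

  packed-zero : Packed (λ _ → 0) (λ _ → 0)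
  packed-zero = record
    { source-legal = [] ; target-legal = [] ; repacking = repacking-[]
    ; source-count = λ _ → refl ; target-count = λ _ → refl }

  packed-add : ∀ {A B u v} m → Generator (A , B) → Packed u v →
               Packed (λ k → m * count k A + u k) (λ k → m * count k B + v k)
  packed-add zero gen packed = packed
  packed-add {A} {B} {u} {v} (suc m) gen@(_ , (legalA , _) , (legalB , _) , _) packed = record
    { source-legal = All.++⁺ legalA source-legal
    ; target-legal = All.++⁺ legalB target-legal
    ; repacking    = repacking-++ gen repacking
    ; source-count = λ k → count-add k A source (source-count k)
    ; target-count = λ k → count-add k B target (target-count k)
    }
    where
    open Packed (packed-add m gen packed)
    count-add : ∀ k C D {w} → count k D ≡ m * count k C + w → count k (C ++ D) ≡ count k C + m * count k C + w
    count-add k C D {w} eq = trans (count-++ k C D)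
      (trans (cong (count k C +_) eq) (sym (ℕ.+-assoc (count k C) (m * count k C) w)))

  packed-combination : ∀ {n} (g : Fin n → Configuration × Configuration) → (∀ j → Generator (g j)) → (x : Fin n → ℕ) →
    Packed (λ k → sum λ j → x j * count k (proj₁ (g j))) (λ k → sum λ j → x j * count k (proj₂ (g j)))
  packed-combination {zero}  g gens x = packed-zero
  packed-combination {suc n} g gens x =
    packed-add (x zero) (gens zero) (packed-combination (g ∘ suc) (gens ∘ suc) (x ∘ suc))

  -- Decomposition of an instance into generators

  generatorCount : Fin (length generators) → Fin 2 → ℕ → ℕ
  generatorCount j s k = count k (bySide (proj₁ (lookup generators j)) (proj₂ (lookup generators j)) s)

  count-tabulate : ∀ {n} k (C : Fin n → Configuration) → count k (concat (tabulate C)) ≡ sum (λ i → count k (C i))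
  count-tabulate {zero}  k C = refl
  count-tabulate {suc n} k C = trans (count-++ k (C zero) _) (cong (count k (C zero) +_) (count-tabulate k (C ∘ suc)))

  Combination : Configuration → Configuration → Set
  Combination C D = ∃ λ (x : Fin (length generators) → ℕ) →
    ∀ s k → sum (λ j → x j * generatorCount j s k) ≡ count k (bySide C D s)

  portion-small : ∀ {P} → Bounded β P → (A : Assignment κ P) → ∀ i → Small (portion A i)
  portion-small bounded A i = legal , ℕ.≤-trans (ℕ.≤-reflexive size) (All.lookup bounded (∈-lookup i))
    where open IsPortion (isPortion A i)

  portion-link : ∀ {P} → Bounded β P → ∀ i {A A′ : Assignment κ P} →
                 AdjacentAssignments A A′ → Link (portion A i) (portion A′ i)
  portion-link bounded i {A} {A′} (j , (adj , others) , _) =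
    portion-small bounded A i , portion-small bounded A′ i ,
    trans P.size (sym P′.size) , ItemLists.↭-trans P.items (ItemLists.↭-sym P′.items) , moved
    where
    module P  = IsPortion (isPortion A i)
    module P′ = IsPortion (isPortion A′ i)
    moved : Adjacent κ (portion A i) (portion A′ i) ⊎ portion A i ≈ᶜ portion A′ i
    moved with i Fin.≟ j
    ... | yes refl = inj₁ adj
    ... | no  i≢j  = inj₂ (others i i≢j)

  -- Projecting the sequence to one index gives a path of links, so the first and last portions of
  -- each part form a generator. This pair occurs literally in the list, which enumerates small
  -- configurations as lists and not up to `≈ᶜ`. The coefficients count how many parts yield each
  -- generator.
  repacking⇒combination : ∀ {C D} → Legal κ C → Legal κ D → Repacking β κ C D → Combination C D
  repacking⇒combination {C} {D} legalC legalD (P , _ , bounded , conforming) =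
    let x , x-counts = multiplicities index-of in
    x , λ s k → trans (x-counts (λ j → generatorCount j s k)) (counts s k)
    where
    open ConformingSequence conforming
    portions : Fin (length P) → Configuration × Configuration
    portions i = portion first i , portion last i
    generator : ∀ i → Generator (portions i)
    generator i =
      ℕ.≤-trans (positive (proj₂ (lookup P i))) (ℕ.≤-reflexive (sym (IsPortion.size (isPortion first i)))) ,
      portion-small bounded first i , portion-small bounded last i ,
      Star.gmap (λ A → portion A i) (λ {A} {A′} → portion-link bounded i {A} {A′}) sequence
    index-of : Fin (length P) → Fin (length generators)
    index-of i = index (∈-generators (generator i))
    index-of-lookup : ∀ i → portions i ≡ lookup generators (index-of i)
    index-of-lookup i = lookup-index (∈-generators (generator i))
    assignment-count : ∀ k {E} (A : Assignment κ P) → Legal κ E → A ConsistentWith E →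
                       sum (λ i → count k (portion A i)) ≡ count k E
    assignment-count k A legalE A≈E = trans (sym (count-tabulate k (portion A)))
      (sym (count-cong k legalE (BunchLists.↭-sym A≈E)))
    counts : ∀ s k → sum (λ i → generatorCount (index-of i) s k) ≡ count k (bySide C D s)
    counts 0F k = trans (sum-cong-≗ λ i → cong (count k ∘ proj₁) (sym (index-of-lookup i)))
      (assignment-count k first legalC first-consistent)
    counts 1F k = trans (sum-cong-≗ λ i → cong (count k ∘ proj₂) (sym (index-of-lookup i)))
      (assignment-count k last legalD last-consistent)

  combination⇒repacking : ∀ {C D} → Legal κ C → Legal κ D →
    (∃ λ (x : Fin (length generators) → ℕ) → ∀ s B → LegalBunch κ B →
       sum (λ j → x j * generatorCount j s (ident B)) ≡ count (ident B) (bySide C D s)) →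
    Repacking β κ C D
  combination⇒repacking {C} {D} legalC legalD (x , eq) = repacking-resp
    (count-injective source-legal legalC λ B l → trans (source-count (ident B)) (eq 0F B l))
    (count-injective target-legal legalD λ B l → trans (target-count (ident B)) (eq 1F B l))
    repacking
    where
    open Packed (packed-combination (lookup generators) generators-generate x)

-- The decision procedure

expand : Listing → Configuration
expand = concatMap λ (B , m) → replicate (value m) B

module ListingCount {κ : ℕ⁺} (I : Identifiers κ) where
  open Identifiers I
  open Counting I
  open Contents I
  open Equivalence

  AllLegal : Listing → Set
  AllLegal = All λ (B , _) → LegalBunch κ B

  -- Multiplicities are positive, so every listed bunch occurs in the expansion and inherits
  -- legality from it.
  listed-legal : ∀ L → Legal κ (expand L) → AllLegal L
  listed-legal []            _     = []
  listed-legal ((B , m) ∷ L) legal =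
    let legalB , legalL = All.++⁻ (replicate (value m) B) legal
    in first (positive m) legalB ∷ listed-legal L legalL
    where
    first : ∀ {n} → 0 < n → Legal κ (replicate n B) → LegalBunch κ B
    first (s≤s _) (l ∷ _) = l

  collected-absent : ∀ {k} L → All (λ (B , _) → ¬ k ≡ ident B) L → collected L k ≡ []
  collected-absent []            []           = refl
  collected-absent {k} ((B , m) ∷ L) (k≢ ∷ absent)
    rewrite collected-absent L absent | dec-false (k ℕ.≟ ident B) k≢ = refl

  -- Distinct legal bunches have distinct identifiers, so at most one pair contributes digits for
  -- `k` and no two numerals are ever joined.
  collected-count : ∀ k L → AllLegal L → AllPairs (λ (B , _) (B′ , _) → ¬ (B ≈ᵇ B′)) L →
                    fromDigits (collected L k) ≡ count k (expand L)
  collected-count k []            []          []                = refl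
  collected-count k ((B , m) ∷ L) (l ∷ legal) (others ∷ distinct) = begin
    fromDigits (collected ((B , m) ∷ L) k)                  ≡⟨ first ⟩
    value m * weight k B + count k (expand L)
      ≡⟨ cong (_+ count k (expand L)) (count-replicate k (value m) B) ⟨
    count k (replicate (value m) B) + count k (expand L)    ≡⟨ count-++ k (replicate (value m) B) (expand L) ⟨
    count k (expand ((B , m) ∷ L))                          ∎
    where
    open ≡-Reasoning
    ds = numeralOf (value m)
    rest : fromDigits (collected L k) ≡ count k (expand L)
    rest = collected-count k L legal distinct
    first : fromDigits (collected ((B , m) ∷ L) k) ≡ value m * weight k B + count k (expand L)
    first with k ℕ.≟ ident B
    ... | no k≢ = begin
      fromDigits (collected ((B , m) ∷ L) k)
        ≡⟨ cong (λ b → fromDigits (collected L k ++ (if b then ds else []))) (dec-false (k ℕ.≟ ident B) k≢) ⟩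
      fromDigits (collected L k ++ [])
        ≡⟨ cong fromDigits (++-identityʳ (collected L k)) ⟩
      fromDigits (collected L k)
        ≡⟨ rest ⟩
      count k (expand L)
        ≡⟨ cong (_+ count k (expand L)) (trans (cong (value m *_) (weight-other {k} {B} k≢)) (ℕ.*-zeroʳ (value m))) ⟨
      value m * weight k B + count k (expand L) ∎
    ... | yes refl = begin
      fromDigits (collected ((B , m) ∷ L) k)
        ≡⟨ cong₂ (λ ds′ b → fromDigits (ds′ ++ (if b then ds else []))) absent (dec-true (k ℕ.≟ ident B) refl) ⟩
      fromDigits ds
        ≡⟨ proj₂ (toDigits 2 (value m)) ⟩
      value m
        ≡⟨ trans (ℕ.+-identityʳ _) (ℕ.*-identityʳ (value m)) ⟨
      value m * 1 + 0
        ≡⟨ cong₂ (λ w c → value m * w + c) (sym (weight-self B)) (trans (cong fromDigits (sym absent)) rest) ⟩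
      value m * weight k B + count k (expand L) ∎
      where
      absent : collected L k ≡ []
      absent = collected-absent L (All.zipWith (λ (B≉ , l′) → B≉ ∘ unique l l′ .to) (others , legal))

  lists-legal : ∀ {L C} → Legal κ C → L Lists C → AllLegal L
  lists-legal {L} legal lists = listed-legal L (legal-resp {κ} (BunchLists.↭-sym (_Lists_.contents lists)) legal)

  lists-count : ∀ k {L C} → Legal κ C → L Lists C → fromDigits (collected L k) ≡ count k C
  lists-count k {L} legal lists = trans (collected-count k L (lists-legal legal lists) distinct)
    (sym (count-cong k legal (BunchLists.↭-sym contents)))
    where open _Lists_ lists

≤-sum : ∀ {m} {ms : List ℕ} → m ∈ ms → m ≤ List.sum ms
≤-sum (here refl) = ℕ.m≤m+n _ _
≤-sum (there m∈)  = ℕ.≤-trans (≤-sum m∈) (ℕ.m≤n+m _ _)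

module Theorem (β κ : ℕ⁺) (I : Identifiers κ) where
  open Identifiers I
  open Counting I
  open Contents I
  open ListingCount I
  open Linking β κ
  open Monoid {β} I

  -- The sum is a crude upper bound for the identifiers of legal bunches; it is fixed before any
  -- instance is given, and so is the number of tapes.
  maxIdent : ℕ
  maxIdent = List.sum (map ident (bunchesUpTo (value κ)))

  ident-bounded : ∀ B → LegalBunch κ B → ident B < suc maxIdent
  ident-bounded B legal = s≤s (≤-sum (∈-map⁺ ident (∈-bunchesUpTo B legal)))

  open Addressing (suc maxIdent)

  address : ∀ s B → LegalBunch κ B → ∃ λ i → side i ≡ s × key i ≡ ident B
  address s B legal = combine s k , cong proj₁ (remQuot-combine s k) ,
    trans (cong (toℕ ∘ proj₂) (remQuot-combine s k)) (toℕ-fromℕ< (ident-bounded B legal))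
    where
    k : Fin (suc maxIdent)
    k = fromℕ< (ident-bounded B legal)

  vector : Fin (length generators) → Fin (2 * suc maxIdent) → ℕ
  vector j i = generatorCount j (side i) (key i)

  -- A side of a generator has at most `β` bunches in total, hence at most `β` of any type.
  vector-bounded : ∀ j i → vector j i ≤ value β
  vector-bounded j i with side i | generators-generate j
  ... | 0F | _ , (_ , |A|≤β) , _ , _ = ℕ.≤-trans (count≤length (key i) (proj₁ (lookup generators j))) |A|≤β
  ... | 1F | _ , _ , (_ , |B|≤β) , _ = ℕ.≤-trans (count≤length (key i) (proj₂ (lookup generators j))) |B|≤β

  open Decider I maxIdent (CarryAutomaton.recogniser vector (value β) vector-bounded)

  module _ {C-S C-T : Configuration} (legal-S : Legal κ C-S) (legal-T : Legal κ C-T)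
           {L-S L-T : Listing} (lists-S : L-S Lists C-S) (lists-T : L-T Lists C-T) where

    side-count : ∀ s k → fromDigits (collected (bySide L-S L-T s) k) ≡ count k (bySide C-S C-T s)
    side-count 0F k = lists-count k legal-S lists-S
    side-count 1F k = lists-count k legal-T lists-T

    -- The automaton compares all tapes, including those whose key identifies no legal bunch, and
    -- `repacking⇒combination` supplies the equation for every key. Conversely the keys of legal
    -- bunches suffice, and `address` finds their tapes.
    combination⇔repacking : (∃ λ x → combination vector x ≗ fromDigits ∘ contents L-S L-T) ⇔ Repacking β κ C-S C-T
    combination⇔repacking = mk⇔
      (λ (x , eq) → combination⇒repacking legal-S legal-T (x , λ s B l → at x eq (address s B l)))
      (λ repacking → let x , eq = repacking⇒combination legal-S legal-T repacking in
        x , λ i → trans (eq (side i) (key i)) (sym (side-count (side i) (key i))))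
      where
      at : ∀ x → combination vector x ≗ fromDigits ∘ contents L-S L-T → ∀ {s k} →
           (∃ λ i → side i ≡ s × key i ≡ k) → sum (λ j → x j * generatorCount j s k) ≡ count k (bySide C-S C-T s)
      at x eq (i , refl , refl) = trans (eq i) (side-count (side i) (key i))

    answers : Answers machine (2 * length (encode I L-S L-T)) (encode I L-S L-T) (Repacking β κ C-S C-T)
    answers =
      let b , halts , correct = decides L-S L-T (in-range legal-S lists-S) (in-range legal-T lists-T)
      in b , halts , combination⇔repacking ⇔-∘ correct
      where
      in-range : ∀ {L C} → Legal κ C → L Lists C → All (λ (B , _) → ident B < suc maxIdent) L
      in-range legal lists = All.map (λ {(B , _)} → ident-bounded B) (lists-legal legal lists)

theorem17 : (β κ : ℕ⁺) (I : Identifiers κ) →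
    Σ[ M ∈ Machine Symbol ] Σ[ c ∈ ℕ ]
    (∀ (C-S C-T : Configuration) → Legal κ C-S → Legal κ C-T →
    ∀ (L-S L-T : Listing) → L-S Lists C-S → L-T Lists C-T →
    Answers M (c * length (encode I L-S L-T)) (encode I L-S L-T)
    (Repacking β κ C-S C-T))
theorem17 β κ I = Decider.machine I maxIdent (CarryAutomaton.recogniser vector (value β) vector-bounded) , 2 ,
  λ _ _ legal-S legal-T _ _ lists-S lists-T → answers legal-S legal-T lists-S lists-T
  where open Theorem β κ I
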